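{- The problems $k$-CONNECTED DOMINATING SET and $k$-DOMINATING CLIQUE, restricted to co-3-track interval graphs (complements of 3-track interval graphs), are both W[1]-hard with parameter $k$.
   Context: A dominating set of a graph $H$ is a set $D$ of vertices such that every vertex of $H$ is in $D$ or adjacent to a vertex of $D$. A connected dominating set is a dominating set $D$ such that the subgraph induced by $D$ is connected. A dominating clique is a set that is both a dominating set and a clique. $k$-CONNECTED DOMINATING SET (resp. $k$-DOMINATING CLIQUE): given a graph $H$ and an integer $k$, decide whether $H$ has a connected dominating set (resp. dominating clique) of $k$ vertices. The intersection graph of a family of sets has one vertex per member, two different members being adjacent iff they intersect; the family is a representation of the graph. A 3-track interval is the union of three intervals on three disjoint parallel lines (tracks), one interval on each track. A 3-track interval graph is the intersection graph of a family of 3-track intervals, and a co-3-track interval graph is the complement of such a graph. A multiple-interval representation (of the 3-track interval graph whose complement is $H$) is given as part of the input. A parameterized problem is W[1]-hard if every problem in W[1] has an FPT reduction to it; equivalently, if $k$-CLIQUE in general graphs (parameter $k$) has an FPT reduction to it. An FPT reduction maps an instance $(x,k)$ to an equivalent instance $(x',k')$ in time $g(k)\cdot|x|^{O(1)}$ with $k'\le h(k)$, for computable functions $g,h$. -}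

module Defs where

open import Data.Bool.Base using (Bool; true; false; not; _∧_; T; if_then_else_)
open import Data.Fin.Base using (Fin)
open import Data.Fin.Properties using (_≟_)
open import Data.Fin.Subset using (Subset; _∈_; ∣_∣)
open import Data.List.Base using (List; []; _∷_; _++_; [_]; length; map; concatMap; allFin)
open import Data.Nat.Base using (ℕ; zero; suc; _+_; _*_; _∸_; _^_; _≤_; _≡ᵇ_)
open import Data.Nat.ListAction using (sum)
open import Data.Nat.Logarithm using (⌊log₂_⌋)
open import Data.Product.Base using (_×_; _,_; ∃-syntax)
open import Data.Sum.Base using (_⊎_)
open import Function.Bundles using (_⇔_)
open import Relation.Binary.Construct.Closure.ReflexiveTransitive using (Star)
open import Relation.Binary.PropositionalEquality using (_≡_; _≢_; refl; sym; cong; cong₂)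
open import Relation.Nullary.Decidable using (does; yes; no)
open import Relation.Nullary.Negation using (contradiction)

------------------------------------------------------------------------
-- Finite simple graphs

record Graph : Set where
  field
    order      : ℕ
    adj        : Fin order → Fin order → Bool
    adj-sym    : ∀ u v → adj u v ≡ adj v u
    adj-irrefl : ∀ u → adj u u ≡ false

  Vertex : Set
  Vertex = Fin order

  Adjacent : Vertex → Vertex → Set
  Adjacent u v = T (adj u v)

open Graph public

private
  ≟-does-sym : ∀ {n} (u v : Fin n) → does (u ≟ v) ≡ does (v ≟ u)
  ≟-does-sym u v with u ≟ v | v ≟ u
  ... | yes _ | yes _ = refl
  ... | no  _ | no  _ = refl
  ... | yes p | no ¬q = contradiction (sym p) ¬q
  ... | no ¬p | yes q = contradiction (sym q) ¬p

  ≟-does-refl : ∀ {n} (u : Fin n) → does (u ≟ u) ≡ true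
  ≟-does-refl u with u ≟ u
  ... | yes _ = refl
  ... | no ¬p = contradiction refl ¬p

complement : Graph → Graph
complement G = record
  { order      = order G
  ; adj        = λ u v → not (does (u ≟ v)) ∧ not (adj G u v)
  ; adj-sym    = λ u v → cong₂ (λ a b → not a ∧ not b) (≟-does-sym u v) (adj-sym G u v)
  ; adj-irrefl = λ u → cong (λ a → not a ∧ not (adj G u u)) (≟-does-refl u)
  }

module _ (H : Graph) (D : Subset (order H)) where

  IsDominating : Set
  IsDominating = ∀ (v : Vertex H) → v ∈ D ⊎ ∃[ u ] (u ∈ D × Adjacent H v u)

  IsClique : Set
  IsClique = ∀ {u v : Vertex H} → u ∈ D → v ∈ D → u ≢ v → Adjacent H u v

  InducedAdjacent : Vertex H → Vertex H → Set
  InducedAdjacent u v = u ∈ D × v ∈ D × Adjacent H u v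

  -- The empty graph counts as connected; for a dominating D this matters
  -- only when H has no vertices.
  InducesConnected : Set
  InducesConnected = ∀ {u v : Vertex H} → u ∈ D → v ∈ D → Star InducedAdjacent u v

  IsConnectedDominating : Set
  IsConnectedDominating = IsDominating × InducesConnected

  IsDominatingClique : Set
  IsDominatingClique = IsDominating × IsClique

HasCliqueOfSize : Graph → ℕ → Set
HasCliqueOfSize G k = ∃[ D ] (∣ D ∣ ≡ k × IsClique G D)

HasConnectedDominatingSetOfSize : Graph → ℕ → Set
HasConnectedDominatingSetOfSize H k = ∃[ D ] (∣ D ∣ ≡ k × IsConnectedDominating H D)

HasDominatingCliqueOfSize : Graph → ℕ → Set
HasDominatingCliqueOfSize H k = ∃[ D ] (∣ D ∣ ≡ k × IsDominatingClique H D)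

------------------------------------------------------------------------
-- 3-track intervals and their intersection graphs

-- Closed intervals with natural endpoints.  Every finite interval family on
-- a line has such a representation, and two such intervals share a real
-- point iff they share an integer point, so lines are modelled by ℕ.
record Interval : Set where
  field
    lo hi : ℕ
    lo≤hi : lo ≤ hi

open Interval public

-- The point (t , p) is position p on track t.
Point : Set
Point = Fin 3 × ℕ

3TrackInterval : Set
3TrackInterval = Fin 3 → Interval

infix 4 _∈ᴵ_

_∈ᴵ_ : Point → 3TrackInterval → Set
(t , p) ∈ᴵ X = lo (X t) ≤ p × p ≤ hi (X t)

Intersect : 3TrackInterval → 3TrackInterval → Set
Intersect X Y = ∃[ x ] (x ∈ᴵ X × x ∈ᴵ Y)

Is3TrackRepresentation : (G : Graph) → (Vertex G → 3TrackInterval) → Set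
Is3TrackRepresentation G F =
  ∀ u v → Adjacent G u v ⇔ (u ≢ v × Intersect (F u) (F v))

------------------------------------------------------------------------
-- Random access machines

-- Structured programs over scalar variables x₀, x₁, … and a memory of cells
-- M[0], M[1], …, all holding naturals, with a write-only output tape.
-- The only unit-cost arithmetic is addition and truncated subtraction, so
-- the bit length of the largest stored number grows by O(1) per step, and
-- the machine is polynomially equivalent to multitape Turing machines.

data Expr : Set where
  lit       : ℕ → Expr
  var       : ℕ → Expr
  load      : Expr → Expr
  _⊕_ _⊖_   : Expr → Expr → Expr

infixl 7 _⊕_ _⊖_

infix  6 _:=_ M[_]:=_
infixr 5 _⨾_

data Program : Set where
  skip          : Program
  _:=_          : ℕ → Expr → Program
  M[_]:=_       : Expr → Expr → Program
  write         : Expr → Program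
  _⨾_           : Program → Program → Program
  ifNonZero     : Expr → Program → Program → Program
  whileNonZero  : Expr → Program → Program

record State : Set where
  constructor state
  field
    vars   : ℕ → ℕ
    memory : ℕ → ℕ
    output : List ℕ

open State public

_[_↦_] : (ℕ → ℕ) → ℕ → ℕ → (ℕ → ℕ)
(f [ i ↦ a ]) j = if i ≡ᵇ j then a else f j

⟦_⟧ : Expr → State → ℕ
⟦ lit a ⟧  σ = a
⟦ var i ⟧  σ = vars σ i
⟦ load e ⟧ σ = memory σ (⟦ e ⟧ σ)
⟦ e ⊕ f ⟧  σ = ⟦ e ⟧ σ + ⟦ f ⟧ σ
⟦ e ⊖ f ⟧  σ = ⟦ e ⟧ σ ∸ ⟦ f ⟧ σ

cost : Expr → ℕ
cost (lit a)  = 1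
cost (var i)  = 1
cost (load e) = suc (cost e)
cost (e ⊕ f)  = suc (cost e + cost f)
cost (e ⊖ f)  = suc (cost e + cost f)

-- p ⊢ σ ⇓ τ in⟨ t ⟩ : started in σ, p halts in τ after t steps.
infix 3 _⊢_⇓_in⟨_⟩

data _⊢_⇓_in⟨_⟩ : Program → State → State → ℕ → Set where

  skip⇓ : ∀ {σ} → skip ⊢ σ ⇓ σ in⟨ 1 ⟩

  assign⇓ : ∀ {σ i e} →
    i := e ⊢ σ ⇓ record σ { vars = vars σ [ i ↦ ⟦ e ⟧ σ ] } in⟨ suc (cost e) ⟩

  store⇓ : ∀ {σ e f} →
    M[ e ]:= f ⊢ σ ⇓ record σ { memory = memory σ [ ⟦ e ⟧ σ ↦ ⟦ f ⟧ σ ] }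
      in⟨ suc (cost e + cost f) ⟩

  write⇓ : ∀ {σ e} →
    write e ⊢ σ ⇓ record σ { output = output σ ++ [ ⟦ e ⟧ σ ] } in⟨ suc (cost e) ⟩

  seq⇓ : ∀ {p q ρ σ τ s t} →
    p ⊢ ρ ⇓ σ in⟨ s ⟩ → q ⊢ σ ⇓ τ in⟨ t ⟩ → p ⨾ q ⊢ ρ ⇓ τ in⟨ s + t ⟩

  ifTrue⇓ : ∀ {e p q σ τ t} → ⟦ e ⟧ σ ≢ 0 →
    p ⊢ σ ⇓ τ in⟨ t ⟩ → ifNonZero e p q ⊢ σ ⇓ τ in⟨ suc (cost e + t) ⟩

  ifFalse⇓ : ∀ {e p q σ τ t} → ⟦ e ⟧ σ ≡ 0 →
    q ⊢ σ ⇓ τ in⟨ t ⟩ → ifNonZero e p q ⊢ σ ⇓ τ in⟨ suc (cost e + t) ⟩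

  whileTrue⇓ : ∀ {e p ρ σ τ s t} → ⟦ e ⟧ ρ ≢ 0 →
    p ⊢ ρ ⇓ σ in⟨ s ⟩ → whileNonZero e p ⊢ σ ⇓ τ in⟨ t ⟩ →
    whileNonZero e p ⊢ ρ ⇓ τ in⟨ suc (cost e + (s + t)) ⟩

  whileFalse⇓ : ∀ {e p σ} → ⟦ e ⟧ σ ≡ 0 →
    whileNonZero e p ⊢ σ ⇓ σ in⟨ suc (cost e) ⟩

cells : List ℕ → ℕ → ℕ
cells []       _       = 0
cells (a ∷ as) zero    = a
cells (a ∷ as) (suc i) = cells as i

-- The input word occupies M[0], M[1], …, and x₀ holds its length.
initial : List ℕ → State
initial w = state ((λ _ → 0) [ 0 ↦ length w ]) (cells w) []

_on_Outputs_Within_ : Program → List ℕ → List ℕ → ℕ → Set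
p on w Outputs w′ Within b =
  ∃[ τ ] ∃[ t ] (p ⊢ initial w ⇓ τ in⟨ t ⟩ × output τ ≡ w′ × t ≤ b)

Computable : (ℕ → ℕ) → Set
Computable f = ∃[ p ] ∀ n → ∃[ b ] (p on [ n ] Outputs [ f n ] Within b)

-- Total bit length of a word of naturals; 0 has bit length 1.
size : List ℕ → ℕ
size w = sum (map (λ a → suc ⌊log₂ a ⌋) w)

------------------------------------------------------------------------
-- Parameterized problems and FPT reductions

record ParameterizedProblem : Set₁ where
  field
    Instance  : Set
    encode    : Instance → List ℕ
    parameter : Instance → ℕ
    Yes       : Instance → Set

open ParameterizedProblem public

infix 4 _≤ᶠᵖᵗ_

record _≤ᶠᵖᵗ_ (P Q : ParameterizedProblem) : Set where
  field
    reduce       : Instance P → Instance Q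
    equivalent   : ∀ x → Yes P x ⇔ Yes Q (reduce x)
    program      : Program
    g h          : ℕ → ℕ
    g-computable : Computable g
    h-computable : Computable h
    degree       : ℕ
    runtime      : ∀ x → program on encode P x Outputs encode Q (reduce x)
                     Within (g (parameter P x) * size (encode P x) ^ degree)
    parameter-≤  : ∀ x → parameter Q (reduce x) ≤ h (parameter P x)

------------------------------------------------------------------------
-- The problems

bit : Bool → ℕ
bit b = if b then 1 else 0

encodeGraph : Graph → List ℕ
encodeGraph G =
  order G ∷ concatMap (λ u → map (λ v → bit (adj G u v)) (allFin (order G))) (allFin (order G))

encode3TrackInterval : 3TrackInterval → List ℕ
encode3TrackInterval X = concatMap (λ t → lo (X t) ∷ hi (X t) ∷ []) (allFin 3)

record GraphInstance : Set where
  field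
    graph : Graph
    k     : ℕ

k-Clique : ParameterizedProblem
k-Clique = record
  { Instance  = GraphInstance
  ; encode    = λ x → let open GraphInstance x in k ∷ encodeGraph graph
  ; parameter = GraphInstance.k
  ; Yes       = λ x → let open GraphInstance x in HasCliqueOfSize graph k
  }

-- A co-3-track interval graph, given together with a 3-track representation
-- of its complement.
record Co3TrackInstance : Set where
  field
    graph          : Graph
    intervals      : Vertex graph → 3TrackInterval
    representation : Is3TrackRepresentation (complement graph) intervals
    k              : ℕ

encodeCo3Track : Co3TrackInstance → List ℕ
encodeCo3Track x = k ∷ encodeGraph graph
                ++ concatMap (λ v → encode3TrackInterval (intervals v)) (allFin (order graph))
  where open Co3TrackInstance x

k-ConnectedDominatingSet-Co3Track : ParameterizedProblem
k-ConnectedDominatingSet-Co3Track = record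
  { Instance  = Co3TrackInstance
  ; encode    = encodeCo3Track
  ; parameter = Co3TrackInstance.k
  ; Yes       = λ x → let open Co3TrackInstance x in HasConnectedDominatingSetOfSize graph k
  }

k-DominatingClique-Co3Track : ParameterizedProblem
k-DominatingClique-Co3Track = record
  { Instance  = Co3TrackInstance
  ; encode    = encodeCo3Track
  ; parameter = Co3TrackInstance.k
  ; Yes       = λ x → let open Co3TrackInstance x in HasDominatingCliqueOfSize graph k
  }

-- W[1] is the class of problems FPT-reducible to k-Clique, so hardness
-- for W[1] amounts to an FPT reduction from k-Clique in general graphs.
W[1]-Hard : ParameterizedProblem → Set
W[1]-Hard Q = k-Clique ≤ᶠᵖᵗ Q

{-# OPTIONS --safe #-}

-- From a graph on n vertices build 3-track intervals in 2k groups, each track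
-- being cut into 2k consecutive blocks.  Group p has n "choice" intervals, one
-- per vertex, lying in block p of every track, and two twin "force" intervals
-- meeting everything except the choices of group p.  Since the twins are not
-- adjacent in the complement H of the intersection graph, a dominating set of
-- H of size 2k consists of exactly one choice, of a vertex z p, per group p.
-- Every other interval X then has to miss one of these choices.  With a prefix
-- of one track, a suffix of another and a segment of the third, X can meet all
-- choices outside two or four groups, and in these groups the choices on one
-- side of a threshold.  The "ordered" intervals thus exclude
-- z (2j) > z (2j + 1), and the "nonEdge" intervals exclude, for i < j and
-- non-adjacent a and b,
--
--   z (2i) ≤ a ≤ z (2i + 1)  and  z (2j) ≤ b ≤ z (2j + 1),
--
-- so that the vertices z (2j) form a clique.  Conversely a clique x yields
-- the choices z (2j) = z (2j + 1) = x j, which are pairwise disjoint and so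
-- form a dominating clique, in particular a connected dominating set.
module Submission where

open import Defs
open import Algebra.Properties.CommutativeSemigroup using (interchange; x∙yz≈y∙xz)
open import Data.Bool.Base using (Bool; true; false; not; _∧_; T)
open import Data.Bool.Properties using (T-∧; T-not-≡)
open import Data.Fin.Base using (Fin; zero; suc; toℕ; fromℕ<)
import Data.Fin.Properties as Fin
open import Data.Fin.Subset using (Subset; _∈_; _∉_; ∣_∣; ⁅_⁆; ⊥; _∪_; inside; outside)
open import Data.Fin.Subset.Properties
  using (_∈?_; x∈⁅x⁆; x∈⁅y⁆⇒x≡y; x∈p∪q⁻; x∈p∪q⁺; q⊆p∪q; p⊂q⇒∣p∣<∣q∣; ∉⊥; ∣⊥∣≡0; ∪-identityˡ)
open import Data.List.Base
  using (List; []; _∷_; _++_; [_]; length; map; concat; concatMap; replicate; tabulate; allFin; lookup)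
open import Data.List.Membership.Propositional using () renaming (_∈_ to _∈ˡ_)
open import Data.List.Membership.Propositional.Properties using (∈-++⁺ˡ; ∈-++⁺ʳ; ∈-++⁻; ∈-lookup)
open import Data.List.Properties
  using (++-assoc; ++-identityʳ; ∷-injective; length-++; concatMap-++; concatMap-map; concatMap-pure;
         map-tabulate; tabulate-lookup; length-tabulate)
open import Data.List.Relation.Unary.Any using (here; there; index)
open import Data.List.Relation.Unary.Any.Properties using (lookup-index)
open import Data.Nat.Base
open import Data.Nat.Logarithm using (⌊log₂_⌋)
open import Data.Nat.Properties
open import Data.Product.Base using (_×_; _,_; ∃-syntax; proj₁; proj₂)
open import Data.Sum.Base using (_⊎_; inj₁; inj₂)
open import Data.Unit.Base using (tt)
import Data.Vec.Base as Vec
open import Function.Base using (_∘_; id)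
open import Function.Bundles using (_⇔_; mk⇔; Equivalence)
open import Relation.Binary.Construct.Closure.ReflexiveTransitive using (ε; _◅_)
open import Relation.Binary.Definitions using (tri<; tri≈; tri>)
open import Relation.Binary.PropositionalEquality hiding ([_]; J)
open import Relation.Nullary.Decidable using (yes; no)
open import Relation.Nullary.Negation using (¬_; contradiction)

-- Verifying machine programs

-- A write beyond the end pads with zeros, the value of every memory cell not listed.
setAt : List ℕ → ℕ → ℕ → List ℕ
setAt []       zero    a = [ a ]
setAt []       (suc i) a = 0 ∷ setAt [] i a
setAt (x ∷ xs) zero    a = a ∷ xs
setAt (x ∷ xs) (suc i) a = x ∷ setAt xs i a

cells-setAt : ∀ xs i a j → cells (setAt xs i a) j ≡ (cells xs [ i ↦ a ]) j
cells-setAt []       zero    a zero    = refl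
cells-setAt []       zero    a (suc j) = refl
cells-setAt []       (suc i) a zero    = refl
cells-setAt []       (suc i) a (suc j) = cells-setAt [] i a j
cells-setAt (x ∷ xs) zero    a zero    = refl
cells-setAt (x ∷ xs) zero    a (suc j) = refl
cells-setAt (x ∷ xs) (suc i) a zero    = refl
cells-setAt (x ∷ xs) (suc i) a (suc j) = cells-setAt xs i a j

cells-∷ʳ : ∀ xs a j → cells (xs ++ [ a ]) j ≡ (cells xs [ length xs ↦ a ]) j
cells-∷ʳ []       a zero    = refl
cells-∷ʳ []       a (suc j) = refl
cells-∷ʳ (x ∷ xs) a zero    = refl
cells-∷ʳ (x ∷ xs) a (suc j) = cells-∷ʳ xs a j

cells-++ˡ : ∀ xs {ys i} → i < length xs → cells (xs ++ ys) i ≡ cells xs i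
cells-++ˡ (x ∷ xs) {i = zero}  _         = refl
cells-++ˡ (x ∷ xs) {i = suc i} (s≤s i<n) = cells-++ˡ xs i<n

cells-++ʳ : ∀ xs {ys} i → cells (xs ++ ys) (length xs + i) ≡ cells ys i
cells-++ʳ []       i = refl
cells-++ʳ (x ∷ xs) i = cells-++ʳ xs i

↦-cong : ∀ {f g : ℕ → ℕ} i {a b} → (∀ j → f j ≡ g j) → a ≡ b →
  ∀ j → (f [ i ↦ a ]) j ≡ (g [ i ↦ b ]) j
↦-cong i f≗g a≡b j with i ≡ᵇ j
... | true  = a≡b
... | false = f≗g j

-- A configuration ⟪ rs , ms , out ⟫ lists x₁, x₂, … and M[0], M[1], …, all
-- later ones being 0; x₀ always holds the length of ms and so addresses the
-- first free cell.
record Configuration : Set where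
  constructor ⟪_,_,_⟫
  field
    registers : List ℕ
    cellList  : List ℕ
    outputs   : List ℕ

open Configuration public

-- The output is left empty, since no expression reads it.
snapshot : List ℕ → List ℕ → State
snapshot rs ms = state (cells (length ms ∷ rs)) (cells ms) []

⟦_⟧ᶜ : Expr → Configuration → ℕ
⟦ e ⟧ᶜ α = ⟦ e ⟧ (snapshot (registers α) (cellList α))

infix 4 _≈_

record _≈_ (σ : State) (α : Configuration) : Set where
  field
    vars≈   : ∀ i → vars σ i ≡ cells (length (cellList α) ∷ registers α) i
    memory≈ : ∀ i → memory σ i ≡ cells (cellList α) i
    output≈ : output σ ≡ outputs α

open _≈_

⟦⟧-cong : ∀ {σ α} → σ ≈ α → ∀ e → ⟦ e ⟧ σ ≡ ⟦ e ⟧ᶜ α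
⟦⟧-cong s (lit a)  = refl
⟦⟧-cong s (var i)  = vars≈ s i
⟦⟧-cong {α = α} s (load e) = trans (memory≈ s _) (cong (cells (cellList α)) (⟦⟧-cong s e))
⟦⟧-cong s (e ⊕ f)  = cong₂ _+_ (⟦⟧-cong s e) (⟦⟧-cong s f)
⟦⟧-cong s (e ⊖ f)  = cong₂ _∸_ (⟦⟧-cong s e) (⟦⟧-cong s f)

cells-replicate-0 : ∀ r i → cells (replicate r 0) i ≡ 0
cells-replicate-0 zero    i       = refl
cells-replicate-0 (suc r) zero    = refl
cells-replicate-0 (suc r) (suc i) = cells-replicate-0 r i

-- All variables but x₀ start at 0, so any number `r` of registers can be listed explicitly.
initial-≈ : ∀ r w → initial w ≈ ⟪ replicate r 0 , w , [] ⟫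
initial-≈ r w = record
  { vars≈   = λ { zero → refl ; (suc i) → sym (cells-replicate-0 r i) }
  ; memory≈ = λ i → refl
  ; output≈ = refl
  }

-- If every loop of p makes at most m rounds each time it is entered, then p
-- takes at most coefficient p * m ^ depth p steps.
coefficient : Program → ℕ
coefficient skip                 = 1
coefficient (i := e)             = suc (cost e)
coefficient (M[ e ]:= f)         = suc (cost e + cost f)
coefficient (write e)            = suc (cost e)
coefficient (p ⨾ q)              = coefficient p + coefficient q
coefficient (ifNonZero e p q)    = suc (cost e) + (coefficient p + coefficient q)
coefficient (whileNonZero e p)   = suc (cost e) + coefficient p + suc (cost e)

depth : Program → ℕ
depth skip               = 0
depth (i := e)           = 0
depth (M[ e ]:= f)       = 0
depth (write e)          = 0
depth (p ⨾ q)            = depth p ⊔ depth q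
depth (ifNonZero e p q)  = depth p ⊔ depth q
depth (whileNonZero e p) = suc (depth p)

push : Expr → Program
push e = M[ var 0 ]:= e ⨾ 0 := (var 0 ⊕ lit 1)

pushes : List Expr → Program
pushes []       = skip
pushes (e ∷ es) = push e ⨾ pushes es

writes : List Expr → Program
writes []       = skip
writes (e ∷ es) = write e ⨾ writes es

-- Unlike a for loop with its counter reset at the start, this one resets it
-- at the end, so that counters are 0 whenever they are not in use.
countUp : ℕ → Expr → Expr → Program → Program
countUp v next e p = whileNonZero e (p ⨾ v := next) ⨾ v := lit 0

module Bounded (m : ℕ) .{{_ : NonZero m}} where

  infix 3 _⊢_⟶_

  -- Total correctness with a time bound, for every state matching the configuration; states contain
  -- functions, which are compared only pointwise.
  _⊢_⟶_ : Program → Configuration → Configuration → Set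
  p ⊢ α ⟶ β = ∀ {σ} → σ ≈ α →
    ∃[ τ ] ∃[ t ] (p ⊢ σ ⇓ τ in⟨ t ⟩ × τ ≈ β × t ≤ coefficient p * m ^ depth p)

  private
    const-≤ : ∀ c d → c ≤ c * m ^ d
    const-≤ c d = m≤m*n c (m ^ d) {{m^n≢0 m d}}

    raise-≤ : ∀ c {d d′} → d ≤ d′ → c * m ^ d ≤ c * m ^ d′
    raise-≤ c d≤d′ = *-monoʳ-≤ c (^-monoʳ-≤ m d≤d′)

    seq-≤ : ∀ {s t} a b d e → s ≤ a * m ^ d → t ≤ b * m ^ e →
      s + t ≤ (a + b) * m ^ (d ⊔ e)
    seq-≤ {s} {t} a b d e s≤ t≤ = subst (s + t ≤_) (sym (*-distribʳ-+ _ a b))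
      (+-mono-≤ (≤-trans s≤ (raise-≤ a (m≤m⊔n d e))) (≤-trans t≤ (raise-≤ b (m≤n⊔m d e))))

  retarget : ∀ {p α β β′} → β ≡ β′ → p ⊢ α ⟶ β → p ⊢ α ⟶ β′
  retarget refl P = P

  skip-run : ∀ {α} → skip ⊢ α ⟶ α
  skip-run s = _ , _ , skip⇓ , s , const-≤ 1 0

  assign-run : ∀ {rs ms out} i e →
    suc i := e ⊢ ⟪ rs , ms , out ⟫ ⟶ ⟪ setAt rs i (⟦ e ⟧ (snapshot rs ms)) , ms , out ⟫
  assign-run {rs} {ms} i e {σ} s = _ , _ , assign⇓ , record
    { vars≈   = λ j → trans (↦-cong (suc i) (vars≈ s) (⟦⟧-cong s e) j)
                            (sym (cells-setAt (length ms ∷ rs) (suc i) _ j))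
    ; memory≈ = memory≈ s
    ; output≈ = output≈ s
    } , const-≤ _ 0

  write-run : ∀ {rs ms out} e →
    write e ⊢ ⟪ rs , ms , out ⟫ ⟶ ⟪ rs , ms , out ++ [ ⟦ e ⟧ (snapshot rs ms) ] ⟫
  write-run e s = _ , _ , write⇓ , record
    { vars≈   = vars≈ s
    ; memory≈ = memory≈ s
    ; output≈ = cong₂ _++_ (output≈ s) (cong [_] (⟦⟧-cong s e))
    } , const-≤ _ 0

  infixr 5 _⨟_

  _⨟_ : ∀ {p q α β γ} → p ⊢ α ⟶ β → q ⊢ β ⟶ γ → p ⨾ q ⊢ α ⟶ γ
  _⨟_ {p} {q} P Q s with P s
  ... | _ , _ , p⇓ , s′ , t≤ with Q s′
  ...   | _ , _ , q⇓ , s″ , u≤ =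
    _ , _ , seq⇓ p⇓ q⇓ , s″ , seq-≤ (coefficient p) (coefficient q) (depth p) (depth q) t≤ u≤

  -- Between the store and the increment x₀ lags behind the cell list, so the two instructions are
  -- verified as one unit.
  push-run : ∀ {rs ms out} e →
    push e ⊢ ⟪ rs , ms , out ⟫ ⟶ ⟪ rs , ms ++ [ ⟦ e ⟧ (snapshot rs ms) ] , out ⟫
  push-run {rs} {ms} e {σ} s = _ , _ , seq⇓ store⇓ assign⇓ , record
    { vars≈   = λ { zero → trans (cong (_+ 1) (vars≈ s 0)) (sym (length-++ ms))
                  ; (suc i) → vars≈ s (suc i) }
    ; memory≈ = λ j → trans
        (trans (cong (λ a → (memory σ [ a ↦ _ ]) j) (vars≈ s 0))
               (↦-cong (length ms) (memory≈ s) (⟦⟧-cong s e) j))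
        (sym (cells-∷ʳ ms _ j))
    ; output≈ = output≈ s
    } , const-≤ _ 0

  -- Each expression is evaluated after the earlier values have been pushed; `ms′` stands for those
  -- values.
  pushes-run : ∀ {rs ms out} es vs →
    (∀ ms′ → map (λ e → ⟦ e ⟧ (snapshot rs (ms ++ ms′))) es ≡ vs) →
    pushes es ⊢ ⟪ rs , ms , out ⟫ ⟶ ⟪ rs , ms ++ vs , out ⟫
  pushes-run [] (_ ∷ _) eq with () ← eq []
  pushes-run {rs} {ms} {out} [] [] eq = retarget
    (cong (λ l → ⟪ rs , l , out ⟫) (sym (++-identityʳ ms))) skip-run
  pushes-run {rs} {ms} {out} (e ∷ es) (v ∷ vs) eq = push-run e ⨟ retarget
    (cong (λ l → ⟪ rs , l , out ⟫)
      (trans (++-assoc ms _ vs) (cong (λ a → ms ++ a ∷ vs) head≡)))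
    (pushes-run es vs λ ms′ → trans
      (cong (λ l → map (λ e′ → ⟦ e′ ⟧ (snapshot rs l)) es) (++-assoc ms _ ms′))
      (proj₂ (∷-injective (eq _))))
    where
    head≡ : ⟦ e ⟧ (snapshot rs ms) ≡ v
    head≡ = trans (cong (λ l → ⟦ e ⟧ (snapshot rs l)) (sym (++-identityʳ ms)))
                  (proj₁ (∷-injective (eq [])))
  pushes-run (e ∷ es) [] eq with () ← eq []

  writes-run : ∀ {rs ms out} es →
    writes es ⊢ ⟪ rs , ms , out ⟫ ⟶
      ⟪ rs , ms , out ++ map (λ e → ⟦ e ⟧ (snapshot rs ms)) es ⟫
  writes-run {rs} {ms} {out} [] = retarget
    (cong (λ l → ⟪ rs , ms , l ⟫) (sym (++-identityʳ out))) skip-run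
  writes-run {rs} {ms} {out} (e ∷ es) = write-run e ⨟ retarget
    (cong (λ l → ⟪ rs , ms , l ⟫) (++-assoc out _ _)) (writes-run es)

  if-run : ∀ {α β e p q} →
    (⟦ e ⟧ᶜ α ≢ 0 → p ⊢ α ⟶ β) → (⟦ e ⟧ᶜ α ≡ 0 → q ⊢ α ⟶ β) →
    ifNonZero e p q ⊢ α ⟶ β
  if-run {α} {β} {e} {p} {q} P Q s with ⟦ e ⟧ᶜ α ≟ 0
  ... | yes ≡0 with Q ≡0 s
  ...   | _ , t , q⇓ , s′ , t≤ =
    _ , _ , ifFalse⇓ (trans (⟦⟧-cong s e) ≡0) q⇓ , s′ ,
    -- The coefficient sums both branches; the one not taken contributes 0 steps.
    seq-≤ (suc (cost e)) (coefficient p + coefficient q) 0 (depth p ⊔ depth q)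
      (const-≤ _ 0) (seq-≤ (coefficient p) (coefficient q) (depth p) (depth q) z≤n t≤)
  if-run {α} {β} {e} {p} {q} P Q s | no ≢0 with P ≢0 s
  ...   | _ , t , p⇓ , s′ , t≤ =
    _ , _ , ifTrue⇓ (≢0 ∘ trans (sym (⟦⟧-cong s e))) p⇓ , s′ ,
    seq-≤ (suc (cost e)) (coefficient p + coefficient q) 0 (depth p ⊔ depth q)
      (const-≤ _ 0)
      (subst (_≤ _) (+-identityʳ t) (seq-≤ (coefficient p) (coefficient q) (depth p) (depth q) t≤ z≤n))

  -- `α i` is the configuration after `i` rounds and plays the part of a loop invariant; `l` is the
  -- exact number of rounds.
  module _ {e p} (α : ℕ → Configuration) {l : ℕ}
           (go   : ∀ {i} → i < l → ⟦ e ⟧ᶜ (α i) ≢ 0)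
           (stop : ⟦ e ⟧ᶜ (α l) ≡ 0)
           (body : ∀ {i} → i < l → p ⊢ α i ⟶ α (suc i)) where

    private
      c round : ℕ
      c     = suc (cost e)
      round = c + coefficient p * m ^ depth p

      -- Induction on the number `j` of rounds still to come; the final `c` pays for the failing
      -- test of the guard.
      rounds : ∀ j i → j + i ≡ l → ∀ {σ} → σ ≈ α i →
        ∃[ τ ] ∃[ t ] (whileNonZero e p ⊢ σ ⇓ τ in⟨ t ⟩ × τ ≈ α l × t ≤ j * round + c)
      rounds zero    i refl s = _ , _ , whileFalse⇓ (trans (⟦⟧-cong s e) stop) , s , ≤-refl
      rounds (suc j) i refl s with i<l ← s≤s (m≤n+m i j) with body i<l s
      ... | _ , t , p⇓ , s′ , t≤ with rounds j (suc i) (+-suc j i) s′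
      ...   | _ , u , w⇓ , s″ , u≤ =
        _ , _ , whileTrue⇓ (go i<l ∘ trans (sym (⟦⟧-cong s e))) p⇓ w⇓ , s″ ,
        subst₂ _≤_ (+-assoc c t u) (sym (+-assoc round (j * round) c))
          (+-mono-≤ (+-monoʳ-≤ c t≤) u≤)

      total : l ≤ m → l * round + c ≤ coefficient (whileNonZero e p) * m ^ suc (depth p)
      total l≤m = begin
        l * round + c
          ≤⟨ +-monoˡ-≤ c (*-mono-≤ l≤m (+-monoˡ-≤ _ (const-≤ c (depth p)))) ⟩
        m * (c * m ^ depth p + coefficient p * m ^ depth p) + c
          ≡⟨ cong (λ z → m * z + c) (sym (*-distribʳ-+ (m ^ depth p) c _)) ⟩
        m * ((c + coefficient p) * m ^ depth p) + c
          ≡⟨ cong (_+ c) (trans (sym (*-assoc m (c + coefficient p) _))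
               (trans (cong (_* m ^ depth p) (*-comm m (c + coefficient p)))
                      (*-assoc (c + coefficient p) m _))) ⟩
        (c + coefficient p) * m ^ suc (depth p) + c
          ≤⟨ +-monoʳ-≤ _ (const-≤ c (suc (depth p))) ⟩
        (c + coefficient p) * m ^ suc (depth p) + c * m ^ suc (depth p)
          ≡⟨ sym (*-distribʳ-+ (m ^ suc (depth p)) (c + coefficient p) c) ⟩
        (c + coefficient p + c) * m ^ suc (depth p) ∎
        where open ≤-Reasoning

    while-run : l ≤ m → whileNonZero e p ⊢ α 0 ⟶ α l
    while-run l≤m s with rounds l 0 (+-identityʳ l) s
    ... | _ , _ , w⇓ , s′ , t≤ = _ , _ , w⇓ , s′ , ≤-trans t≤ (total l≤m)

  run-outputs : ∀ {p w r β w′} → p ⊢ ⟪ replicate r 0 , w , [] ⟫ ⟶ β → outputs β ≡ w′ →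
    p on w Outputs w′ Within (coefficient p * m ^ depth p)
  run-outputs {w = w} {r} P β≡w′ with P (initial-≈ r w)
  ... | τ , t , p⇓ , τ≈β , t≤ = τ , t , p⇓ , trans (output≈ τ≈β) β≡w′ , t≤

-- Loops that append to a growing list

collect : ∀ {A : Set} → (ℕ → List A) → ℕ → List A
collect g zero    = []
collect g (suc n) = collect g n ++ g n

-- Index `i` means the variable with number i + 1, as the register list starts with x₁.
setRegister : ℕ → ℕ → Configuration → Configuration
setRegister i a α = record α { registers = setAt (registers α) i a }

-- `α acc vs` is the configuration with accumulated list `acc` and register contents `vs`; the list
-- is later the interval table or the output.
module Accumulating (m : ℕ) .{{_ : NonZero m}}
                    {A : Set} (α : List A → List ℕ → Configuration) where

  open Bounded m

  Appends : Program → List ℕ → List ℕ → List A → Set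
  Appends p vs vs′ xs = ∀ acc → p ⊢ α acc vs ⟶ α (acc ++ xs) vs′

  infixr 5 _⨾ᵃ_

  _⨾ᵃ_ : ∀ {p q vs vs′ vs″ xs ys} →
    Appends p vs vs′ xs → Appends q vs′ vs″ ys → Appends (p ⨾ q) vs vs″ (xs ++ ys)
  _⨾ᵃ_ {vs″ = vs″} {xs} {ys} P Q acc =
    P acc ⨟ retarget (cong (λ l → α l vs″) (++-assoc acc xs ys)) (Q (acc ++ xs))

  assign-appends : ∀ {vs vs′ i e} →
    (∀ acc → setRegister i (⟦ e ⟧ᶜ (α acc vs)) (α acc vs) ≡ α acc vs′) →
    Appends (suc i := e) vs vs′ []
  assign-appends {vs} {vs′} {i} {e} eq acc = retarget
    (trans (eq acc) (cong (λ l → α l vs′) (sym (++-identityʳ acc)))) (assign-run i e)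

  skip-appends : ∀ {vs} → Appends skip vs vs []
  skip-appends {vs} acc =
    retarget (cong (λ l → α l vs) (sym (++-identityʳ acc))) skip-run

  -- The registers are `vs i` at the start of round `i`, and `vs′ i` after the body but before the
  -- counter advances.
  count-appends : ∀ {v next e p} (vs vs′ : ℕ → List ℕ) (g : ℕ → List A) {l} → l ≤ m →
    (∀ {i} acc → i < l → ⟦ e ⟧ᶜ (α acc (vs i)) ≢ 0) →
    (∀ acc → ⟦ e ⟧ᶜ (α acc (vs l)) ≡ 0) →
    (∀ {i} → i < l → Appends p (vs i) (vs′ i) (g i)) →
    (∀ i acc → setRegister v (⟦ next ⟧ᶜ (α acc (vs′ i))) (α acc (vs′ i)) ≡ α acc (vs (suc i))) →
    ∀ {vs″} → (∀ acc → setRegister v 0 (α acc (vs l)) ≡ α acc vs″) →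
    Appends (countUp (suc v) next e p) (vs 0) vs″ (collect g l)
  count-appends {v} {next} {e} {p} vs vs′ g {l} l≤m go stop body step {vs″} reset acc =
    subst (λ l₀ → whileNonZero e (p ⨾ suc v := next) ⊢ α l₀ (vs 0) ⟶ family l) (++-identityʳ acc)
      (while-run family (λ {i} → go (acc ++ collect g i)) (stop _) round l≤m)
    ⨟ retarget (reset _) (assign-run v (lit 0))
    where
    family : ℕ → Configuration
    family i = α (acc ++ collect g i) (vs i)
    round : ∀ {i} → i < l → p ⨾ suc v := next ⊢ family i ⟶ family (suc i)
    round {i} i<l =
      retarget (cong (λ l₀ → α l₀ (vs′ i)) (++-assoc acc (collect g i) (g i)))
               (body i<l (acc ++ collect g i))
      ⨟ retarget (step i _) (assign-run v next)

-- The 3-track intervals of the reduction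

-- The interval [l, h] if l ≤ h, and [l, l] otherwise.
span : ℕ → ℕ → Interval
span l h = record { lo = l ; hi = l + (h ∸ l) ; lo≤hi = m≤m+n l (h ∸ l) }

threeTracks : Interval → Interval → Interval → 3TrackInterval
threeTracks I J K zero             = I
threeTracks I J K (suc zero)       = J
threeTracks I J K (suc (suc zero)) = K

-- `force` and `choice` name a group, `ordered` and `nonEdge` name pairs j of groups 2j and 2j + 1.
-- The further numbers are vertices, or in `ordered` a threshold. The Boolean of `force` tells the
-- twins apart.
data Kind : Set where
  force   : Bool → ℕ → Kind
  choice  : ℕ → ℕ → Kind
  ordered   : ℕ → ℕ → Kind
  nonEdge : ℕ → ℕ → ℕ → ℕ → Kind

module Layout (k n : ℕ) where

  -- Offsets used inside a block run from 1 to 2n + 1, so block boundaries stay free.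
  width : ℕ
  width = 2 + (n + n)

  base : ℕ → ℕ
  base p = p * width

  end : ℕ
  end = base (k * 2)

  -- Block p occupies the positions strictly between base p and base (suc p);
  -- within it left ends precede right ends, and both increase with the
  -- chosen vertex, except for the left ends on the third track and the right
  -- ends on the first, which decrease.
  intervals : Kind → 3TrackInterval
  intervals (force _ p) = threeTracks
    (span 0 (base p))
    (span (base (suc p)) end)
    (span 0 0)
  intervals (choice p x) = threeTracks
    (span (base p + (1 + x))       (base p + (1 + (n + (n ∸ x)))))
    (span (base p + (1 + x))       (base p + (1 + (n + x))))
    (span (base p + (1 + (n ∸ x))) (base p + (1 + (n + x))))
  intervals (ordered j w) = threeTracks
    (span (base (suc (j * 2)) + (2 + (n + w))) end)
    (span 0 0)
    (span 0 (base (j * 2) + (1 + w)))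
  intervals (nonEdge i j a b) = threeTracks
    (span 0 (base (i * 2) + (1 + a)))
    (span (base (suc (i * 2)) + (1 + (n + a))) (base (j * 2) + (1 + b)))
    (span (base (suc (j * 2)) + (1 + (n + b))) end)

  encodeKind : Kind → List ℕ
  encodeKind κ = encode3TrackInterval (intervals κ)

unlessNonZero : ∀ {A : Set} → ℕ → A → List A
unlessNonZero zero    x = [ x ]
unlessNonZero (suc _) x = []

module Table (k n : ℕ) (bits : List ℕ) where

  entry : ℕ → ℕ → ℕ
  entry a b = cells bits (b + a * n)

  selectors : ℕ → List Kind
  selectors j =
    force false (j * 2)       ∷ force true (j * 2) ∷
    force false (suc (j * 2)) ∷ force true (suc (j * 2)) ∷ []

  choices : ℕ → ℕ → List Kind
  choices j x = choice (j * 2) x ∷ choice (suc (j * 2)) x ∷ ordered j x ∷ []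

  -- The diagonal of an adjacency matrix is 0, so a = b is covered too; this forces the selected
  -- vertices to be distinct.
  nonEdges : ℕ → ℕ → List Kind
  nonEdges j i =
    collect (λ a → collect (λ b → unlessNonZero (entry a b) (nonEdge i j a b)) n) n

  table : List Kind
  table = collect (λ j → selectors j ++ collect (choices j) n ++ collect (nonEdges j) j) k

-- The reducing program

spanExprs : Expr → Expr → List Expr
spanExprs l h = l ∷ (l ⊕ (h ⊖ l)) ∷ []

pushKind : List Expr → Program
pushKind es = pushes es ⨾ 5 := (lit 1 ⊕ var 5)

pushForce : Expr → Program
pushForce base = pushKind
  (spanExprs (lit 0) base ++ spanExprs (var 3 ⊕ base) (var 4) ++ spanExprs (lit 0) (lit 0))

pushChoice : Expr → Program
pushChoice base = pushKind
  (spanExprs (base ⊕ (lit 1 ⊕ x))  (base ⊕ (lit 1 ⊕ (n ⊕ n∸x))) ++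
   spanExprs (base ⊕ (lit 1 ⊕ x))  (base ⊕ (lit 1 ⊕ (n ⊕ x))) ++
   spanExprs (base ⊕ (lit 1 ⊕ n∸x)) (base ⊕ (lit 1 ⊕ (n ⊕ x))))
  where
  n = var 2
  x = var 7
  n∸x = n ⊖ x

pushOrder : Program
pushOrder = pushKind
  (spanExprs ((var 3 ⊕ var 6) ⊕ (lit 2 ⊕ (var 2 ⊕ var 7))) (var 4) ++
   spanExprs (lit 0) (lit 0) ++
   spanExprs (lit 0) (var 6 ⊕ (lit 1 ⊕ var 7)))

pushNonEdge : Program
pushNonEdge = pushKind
  (spanExprs (lit 0) (var 8 ⊕ (lit 1 ⊕ var 9)) ++
   spanExprs ((var 3 ⊕ var 8) ⊕ (lit 1 ⊕ (var 2 ⊕ var 9))) (var 6 ⊕ (lit 1 ⊕ var 10)) ++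
   spanExprs ((var 3 ⊕ var 6) ⊕ (lit 1 ⊕ (var 2 ⊕ var 10))) (var 4))

-- For want of a multiplication instruction, x₈ advances by two block widths per round and is itself
-- the position of block 2i; x₁₁ likewise accumulates a * n.
pushNonEdges : Program
pushNonEdges =
  countUp 8 (var 3 ⊕ (var 3 ⊕ var 8)) (var 6 ⊖ var 8)
    (countUp 9 (lit 1 ⊕ var 9) (var 2 ⊖ var 9)
      (countUp 10 (lit 1 ⊕ var 10) (var 2 ⊖ var 10)
        (ifNonZero (load (lit 2 ⊕ (var 10 ⊕ var 11))) skip pushNonEdge)
       ⨾ 11 := (var 2 ⊕ var 11))
     ⨾ 11 := lit 0)

pushRow : Program
pushRow =
  (pushForce (var 6) ⨾ pushForce (var 6) ⨾
   pushForce (var 3 ⊕ var 6) ⨾ pushForce (var 3 ⊕ var 6)) ⨾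
  countUp 7 (lit 1 ⊕ var 7) (var 2 ⊖ var 7)
    (pushChoice (var 6) ⨾ pushChoice (var 3 ⊕ var 6) ⨾ pushOrder) ⨾
  pushNonEdges

setup : Program
setup =
  1 := var 0 ⨾
  2 := load (lit 1) ⨾
  3 := (lit 2 ⊕ (var 2 ⊕ var 2)) ⨾
  -- The end position, 2k block widths, is summed up in k rounds.
  countUp 7 (lit 1 ⊕ var 7) (load (lit 0) ⊖ var 7) (4 := (var 3 ⊕ (var 3 ⊕ var 4)))

buildTable : Program
buildTable = countUp 6 (var 3 ⊕ (var 3 ⊕ var 6)) (var 4 ⊖ var 6) pushRow

endpoint : ℕ → Expr → Expr
endpoint c i = load (var 1 ⊕ (lit c ⊕ i))

-- With truncated subtraction the sum is positive iff one interval ends before the other begins.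
-- Track t has its left end at offset c = 2t.
gapExpr : ℕ → Expr
gapExpr c =
  (endpoint c (var 12) ⊖ endpoint (suc c) (var 13)) ⊕
  (endpoint c (var 13) ⊖ endpoint (suc c) (var 12))

sgnExpr : Expr → Expr
sgnExpr e = lit 1 ⊖ (lit 1 ⊖ e)

-- Each sign is 1 if the intervals are apart on that track and 0 otherwise, so subtracting 2 leaves
-- 1 only when all three tracks separate them.
adjacencyExpr : Expr
adjacencyExpr = (sgnExpr (gapExpr 0) ⊕ (sgnExpr (gapExpr 2) ⊕ sgnExpr (gapExpr 4))) ⊖ lit 2

-- A table entry takes six cells, two ends on each of three tracks, and x₀ minus x₁ is the number of
-- table cells.
writeMatrix : Program
writeMatrix =
  countUp 12 (lit 6 ⊕ var 12) ((var 0 ⊖ var 1) ⊖ var 12)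
    (countUp 13 (lit 6 ⊕ var 13) ((var 0 ⊖ var 1) ⊖ var 13)
      (write adjacencyExpr))

writeIntervals : Program
writeIntervals =
  countUp 12 (lit 6 ⊕ var 12) ((var 0 ⊖ var 1) ⊖ var 12)
    (writes (map (λ c → endpoint c (var 12)) (0 ∷ 1 ∷ 2 ∷ 3 ∷ 4 ∷ 5 ∷ [])))

-- Variables: x₁ the start of the table (the input length), x₂ = n, x₃ the
-- width of a block, x₄ the end position, x₅ the number of table entries, x₆
-- and x₈ the positions of blocks 2j and 2i, x₇ a vertex or a threshold,
-- x₉ = a, x₁₀ = b, x₁₁ = a * n, x₁₂ and x₁₃ offsets into the table.
reduction : Program
reduction = setup ⨾ buildTable ⨾
  writes ((load (lit 0) ⊕ load (lit 0)) ∷ var 5 ∷ []) ⨾ writeMatrix ⨾ writeIntervals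

-- Correctness of the reducing program

sgn : ℕ → ℕ
sgn d = 1 ∸ (1 ∸ d)

-- `m` bounds `k`, `n` and the table length, and thereby the rounds of every loop.
module Correctness (m : ℕ) .{{_ : NonZero m}} (k n : ℕ) (bits : List ℕ)
                   (|bits| : length bits ≡ n * n)
                   (k≤m : k ≤ m) (n≤m : n ≤ m)
                   (|table|≤m : length (Table.table k n bits) ≤ m) where

  open Bounded m
  open Layout k n
  open Table k n bits

  word : List ℕ
  word = k ∷ n ∷ bits

  store : List Kind → List ℕ
  store ks = word ++ concatMap encodeKind ks

  building : List Kind → List ℕ → Configuration
  building ks vs =
    ⟪ length word ∷ n ∷ width ∷ end ∷ length ks ∷ vs , store ks , [] ⟫

  writing : List ℕ → List ℕ → Configuration
  writing out vs =
    ⟪ length word ∷ n ∷ width ∷ end ∷ length table ∷ vs , store table , out ⟫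

  module B = Accumulating m building
  module W = Accumulating m writing

  -- The endpoint expressions read neither memory nor x₀ nor the entry count x₅, so the equation is
  -- asked for all `c` and `ms` and holds by `refl` at each use.
  pushKind-appends : ∀ {vs} es κ →
    (∀ c ms → map (λ e → ⟦ e ⟧ (snapshot (length word ∷ n ∷ width ∷ end ∷ c ∷ vs) ms)) es
            ≡ encodeKind κ) →
    B.Appends (pushKind es) vs vs [ κ ]
  pushKind-appends {vs} es κ eq ks =
    pushes-run es (encodeKind κ) (λ ms′ → eq (length ks) (store ks ++ ms′)) ⨟
    retarget (cong₂ (λ c ms → ⟪ length word ∷ n ∷ width ∷ end ∷ c ∷ vs , ms , [] ⟫)
               (trans (+-comm 1 (length ks)) (sym (length-++ ks)))
               (trans (++-assoc word (concatMap encodeKind ks) _)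
                 (cong (word ++_) (trans
                   (cong (concatMap encodeKind ks ++_) (sym (++-identityʳ (encodeKind κ))))
                   (sym (concatMap-++ encodeKind ks [ κ ]))))))
      (assign-run 4 (lit 1 ⊕ var 5))

  -- The registers x₆, x₇, …
  counters : ℕ → ℕ → ℕ → ℕ → ℕ → ℕ → List ℕ
  counters j x i a b r = j ∷ x ∷ i ∷ a ∷ b ∷ r ∷ 0 ∷ 0 ∷ []

  guard-go : ∀ {i l} → i < l → l ∸ i ≢ 0
  guard-go = m>n⇒m∸n≢0

  base-< : ∀ {i j} → i < j → base (i * 2) < base (j * 2)
  base-< i<j = *-monoˡ-< width (*-monoˡ-< 2 i<j)

  -- The table grows behind the input, so the matrix, which starts at M[2], stays readable.
  entry-run : ∀ {a b} ks → a < n → b < n →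
    cells (store ks) (2 + (b + a * n)) ≡ entry a b
  entry-run {a} {b} ks a<n b<n = cells-++ˡ bits (subst (_ <_) (sym |bits|)
    (<-≤-trans (+-monoˡ-< (a * n) b<n) (*-monoˡ-≤ n a<n)))

  nonEdge-appends : ∀ {j i a b} → a < n → b < n →
    let vs = counters (base (j * 2)) 0 (base (i * 2)) a b (a * n) in
    B.Appends (ifNonZero (load (lit 2 ⊕ (var 10 ⊕ var 11))) skip pushNonEdge)
      vs vs (unlessNonZero (entry a b) (nonEdge i j a b))
  nonEdge-appends {j} {i} {a} {b} a<n b<n ks with entry a b in eq
  ... | zero  = if-run (λ ≢0 → contradiction (trans (entry-run ks a<n b<n) eq) ≢0)
                       (λ _ → pushKind-appends _ (nonEdge i j a b) (λ _ _ → refl) ks)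
  ... | suc _ = if-run (λ _ → B.skip-appends ks)
                       (λ ≡0 → contradiction (trans (sym eq) (trans (sym (entry-run ks a<n b<n)) ≡0)) λ ())

  nonEdges-appends : ∀ j → j ≤ m →
    let vs = counters (base (j * 2)) 0 0 0 0 0 in
    B.Appends pushNonEdges vs vs (collect (nonEdges j) j)
  nonEdges-appends j j≤m =
    B.count-appends (λ i → counters J 0 (base (i * 2)) 0 0 0)
                    (λ i → counters J 0 (base (i * 2)) 0 0 0) (nonEdges j)
      j≤m (λ _ → guard-go ∘ base-<) (λ _ → n∸n≡0 J)
      (λ {i} _ → subst (B.Appends _ _ _) (++-identityʳ _)
        (B.count-appends (λ a → counters J 0 (base (i * 2)) a 0 (a * n))
                         -- At the end of the body x₁₁ has moved on to the next row, while the
                         -- counter `a` has not.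
                         (λ a → counters J 0 (base (i * 2)) a 0 (suc a * n)) _
           n≤m (λ _ → guard-go) (λ _ → n∸n≡0 n)
           (λ {a} a<n → subst (B.Appends _ _ _) (++-identityʳ _)
             (B.count-appends (λ b → counters J 0 (base (i * 2)) a b (a * n))
                              (λ b → counters J 0 (base (i * 2)) a b (a * n)) _
               n≤m (λ _ → guard-go) (λ _ → n∸n≡0 n)
               (λ b<n → nonEdge-appends {j} {i} a<n b<n)
               (λ _ _ → refl) (λ _ → refl)
             B.⨾ᵃ B.assign-appends λ _ → refl))
           (λ _ _ → refl) (λ _ → refl)
         B.⨾ᵃ B.assign-appends λ _ → refl))
      (λ _ _ → refl) (λ _ → refl)
    where J = base (j * 2)

  row-appends : ∀ j → j ≤ m →
    let vs = counters (base (j * 2)) 0 0 0 0 0 in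
    B.Appends pushRow vs vs (selectors j ++ collect (choices j) n ++ collect (nonEdges j) j)
  row-appends j j≤m =
    (pushKind-appends _ (force false (j * 2)) (λ _ _ → refl) B.⨾ᵃ
     pushKind-appends _ (force true (j * 2)) (λ _ _ → refl) B.⨾ᵃ
     pushKind-appends _ (force false (suc (j * 2))) (λ _ _ → refl) B.⨾ᵃ
     pushKind-appends _ (force true (suc (j * 2))) (λ _ _ → refl)) B.⨾ᵃ
    B.count-appends (λ x → counters J x 0 0 0 0) (λ x → counters J x 0 0 0 0) (choices j)
      n≤m (λ _ → guard-go) (λ _ → n∸n≡0 n)
      (λ {x} _ →
        pushKind-appends _ (choice (j * 2) x) (λ _ _ → refl) B.⨾ᵃ
        pushKind-appends _ (choice (suc (j * 2)) x) (λ _ _ → refl) B.⨾ᵃ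
        pushKind-appends _ (ordered j x) (λ _ _ → refl))
      (λ _ _ → refl) (λ _ → refl) B.⨾ᵃ
    nonEdges-appends j j≤m
    where J = base (j * 2)

  build-appends :
    let vs = counters 0 0 0 0 0 0 in B.Appends buildTable vs vs table
  build-appends =
    B.count-appends (λ j → counters (base (j * 2)) 0 0 0 0 0)
                    (λ j → counters (base (j * 2)) 0 0 0 0 0) _
      k≤m (λ _ → guard-go ∘ base-<) (λ _ → n∸n≡0 end)
      (λ {j} j<k → row-appends j (≤-trans (<⇒≤ j<k) k≤m))
      (λ _ _ → refl) (λ _ → refl)

  -- The setup appends nothing; a dummy list, ignored by the configuration, lets it use the same
  -- loop rule.
  module S = Accumulating m {ℕ} (λ _ vs → ⟪ vs , word , [] ⟫)

  -- The 13 zeros are the registers x₁ to x₁₃ of the program.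
  setup-run : setup ⊢ ⟪ replicate 13 0 , word , [] ⟫ ⟶ building [] (counters 0 0 0 0 0 0)
  setup-run =
    assign-run 0 _ ⨟ assign-run 1 _ ⨟ assign-run 2 _ ⨟
    retarget (cong (λ ms → ⟪ length word ∷ n ∷ width ∷ end ∷ 0 ∷ counters 0 0 0 0 0 0 , ms , [] ⟫)
                   (sym (++-identityʳ word)))
    (S.count-appends
      (λ i → length word ∷ n ∷ width ∷ base (i * 2) ∷ 0 ∷ counters 0 i 0 0 0 0)
      (λ i → length word ∷ n ∷ width ∷ base (suc i * 2) ∷ 0 ∷ counters 0 i 0 0 0 0)
      (λ _ → [])
      k≤m (λ _ → guard-go) (λ _ → n∸n≡0 k)
      (λ _ → S.assign-appends λ _ → refl) (λ _ _ → refl) (λ _ → refl) [])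

  length-encodeKinds : ∀ ks → length (concatMap encodeKind ks) ≡ length ks * 6
  length-encodeKinds []       = refl
  length-encodeKinds (κ ∷ ks) = cong (6 +_) (length-encodeKinds ks)

  endpointAt : ℕ → ℕ → ℕ
  endpointAt c i = cells (store table) (length word + (c + i * 6))

  gapAt : ℕ → ℕ → ℕ → ℕ
  gapAt c u v =
    (endpointAt c u ∸ endpointAt (suc c) v) + (endpointAt c v ∸ endpointAt (suc c) u)

  adjacencyAt : ℕ → ℕ → ℕ
  adjacencyAt u v = (sgn (gapAt 0 u v) + (sgn (gapAt 2 u v) + sgn (gapAt 4 u v))) ∸ 2

  matrix : List ℕ
  matrix = collect (λ u → collect (λ v → [ adjacencyAt u v ]) (length table)) (length table)

  endpoints : List ℕ
  endpoints = collect (λ u → map (λ c → endpointAt c u) (0 ∷ 1 ∷ 2 ∷ 3 ∷ 4 ∷ 5 ∷ [])) (length table)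

  private
    pointers : ℕ → ℕ → List ℕ
    pointers u v = 0 ∷ 0 ∷ 0 ∷ 0 ∷ 0 ∷ 0 ∷ u * 6 ∷ v * 6 ∷ []

    tableBytes : ∀ i → length (store table) ∸ length word ∸ i ≡ length table * 6 ∸ i
    tableBytes i = cong (_∸ i) (trans
      (cong (_∸ length word) (length-++ word))
      (trans (m+n∸m≡n (length word) _) (length-encodeKinds table)))

    pointer-go : ∀ {i} → i < length table → length (store table) ∸ length word ∸ i * 6 ≢ 0
    pointer-go {i} i<N ≡0 = guard-go (*-monoˡ-< 6 i<N) (trans (sym (tableBytes (i * 6))) ≡0)

    pointer-stop : length (store table) ∸ length word ∸ length table * 6 ≡ 0
    pointer-stop = trans (tableBytes (length table * 6)) (n∸n≡0 (length table * 6))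

  writeMatrix-appends : W.Appends writeMatrix (pointers 0 0) (pointers 0 0) matrix
  writeMatrix-appends =
    W.count-appends (λ u → pointers u 0) (λ u → pointers u 0) _
      |table|≤m (λ _ → pointer-go) (λ _ → pointer-stop)
      (λ {u} _ → W.count-appends (pointers u) (pointers u) _
        |table|≤m (λ _ → pointer-go) (λ _ → pointer-stop)
        (λ _ _ → write-run adjacencyExpr) (λ _ _ → refl) (λ _ → refl))
      (λ _ _ → refl) (λ _ → refl)

  writeIntervals-appends : W.Appends writeIntervals (pointers 0 0) (pointers 0 0) endpoints
  writeIntervals-appends =
    W.count-appends (λ u → pointers u 0) (λ u → pointers u 0) _
      |table|≤m (λ _ → pointer-go) (λ _ → pointer-stop)
      (λ _ _ → writes-run _) (λ _ _ → refl) (λ _ → refl)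

  reduction-run : reduction ⊢ ⟪ replicate 13 0 , word , [] ⟫ ⟶
    writing (k + k ∷ length table ∷ matrix ++ endpoints) (pointers 0 0)
  reduction-run =
    setup-run ⨟ build-appends [] ⨟
    writes-run ((load (lit 0) ⊕ load (lit 0)) ∷ var 5 ∷ []) ⨟
    (writeMatrix-appends W.⨾ᵃ writeIntervals-appends) _

-- Disjointness graphs

positive : ℕ → Bool
positive zero    = false
positive (suc _) = true

gap : Interval → Interval → ℕ
gap I J = (lo I ∸ hi J) + (lo J ∸ hi I)

all₃ : (Fin 3 → Bool) → Bool
all₃ f = f zero ∧ (f (suc zero) ∧ f (suc (suc zero)))

all₃⁺ : ∀ f → (∀ t → T (f t)) → T (all₃ f)
all₃⁺ f ts = T-∧ {f zero} .Equivalence.from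
  (ts zero , T-∧ {f (suc zero)} .Equivalence.from (ts (suc zero) , ts (suc (suc zero))))

all₃⁻ : ∀ f → T (all₃ f) → ∀ t → T (f t)
all₃⁻ f p with T-∧ {f zero} .Equivalence.to p
... | p₀ , q with T-∧ {f (suc zero)} .Equivalence.to q
...   | p₁ , p₂ = λ { zero → p₀ ; (suc zero) → p₁ ; (suc (suc zero)) → p₂ }

¬all₃⁻ : ∀ f → ¬ T (all₃ f) → ∃[ t ] f t ≡ false
¬all₃⁻ f ¬p with f zero in eq₀ | f (suc zero) in eq₁ | f (suc (suc zero)) in eq₂
... | false | _     | _     = _ , eq₀
... | true  | false | _     = _ , eq₁
... | true  | true  | false = _ , eq₂
... | true  | true  | true  = contradiction tt ¬p

separate : 3TrackInterval → 3TrackInterval → Fin 3 → Bool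
separate X Y t = positive (gap (X t) (Y t))

disjoint : 3TrackInterval → 3TrackInterval → Bool
disjoint X Y = all₃ (separate X Y)

meet-gap : ∀ {I J} → lo I ≤ hi J → lo J ≤ hi I → gap I J ≡ 0
meet-gap I≤J J≤I = cong₂ _+_ (m≤n⇒m∸n≡0 I≤J) (m≤n⇒m∸n≡0 J≤I)

positive-gap : ∀ {I J} → hi I < lo J ⊎ hi J < lo I → T (positive (gap I J))
positive-gap {I} {J} apart with gap I J in eq
... | suc _ = tt
positive-gap {I} {J} (inj₁ I<J) | zero =
  contradiction (m+n≡0⇒n≡0 (lo I ∸ hi J) eq) (m>n⇒m∸n≢0 I<J)
positive-gap {I} {J} (inj₂ J<I) | zero =
  contradiction (m+n≡0⇒m≡0 (lo I ∸ hi J) eq) (m>n⇒m∸n≢0 J<I)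

-- The larger of the two left ends is a common point.
meet : ∀ {X Y} t → lo (X t) ≤ hi (Y t) → lo (Y t) ≤ hi (X t) → Intersect X Y
meet {X} {Y} t X≤Y Y≤X = (t , lo (X t) ⊔ lo (Y t)) ,
  (m≤m⊔n _ _ , ⊔-lub (lo≤hi (X t)) Y≤X) , (m≤n⊔m _ _ , ⊔-lub X≤Y (lo≤hi (Y t)))

apart-disjoint : ∀ X Y → (∀ t → hi (X t) < lo (Y t) ⊎ hi (Y t) < lo (X t)) → T (disjoint X Y)
apart-disjoint X Y apart = all₃⁺ (separate X Y) λ t → positive-gap {X t} {Y t} (apart t)

intersect⇒¬disjoint : ∀ X Y → Intersect X Y → ¬ T (disjoint X Y)
intersect⇒¬disjoint X Y ((t , p) , (X≤p , p≤X) , (Y≤p , p≤Y)) d =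
  subst (T ∘ positive) (meet-gap {X t} {Y t} (≤-trans X≤p p≤Y) (≤-trans Y≤p p≤X))
    (all₃⁻ (separate X Y) d t)

¬disjoint⇒intersect : ∀ {X Y} → ¬ T (disjoint X Y) → Intersect X Y
¬disjoint⇒intersect {X} {Y} ¬d with ¬all₃⁻ (separate X Y) ¬d
... | t , eq with gap (X t) (Y t) in eq′
...   | zero = meet {X} {Y} t (m∸n≡0⇒m≤n (m+n≡0⇒m≡0 _ eq′))
                      (m∸n≡0⇒m≤n (m+n≡0⇒n≡0 (lo (X t) ∸ hi (Y t)) eq′))

disjoint-sym : ∀ X Y → disjoint X Y ≡ disjoint Y X
disjoint-sym X Y = cong₂ _∧_ (gap-sym zero) (cong₂ _∧_ (gap-sym (suc zero)) (gap-sym (suc (suc zero))))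
  where
  gap-sym : ∀ t → positive (gap (X t) (Y t)) ≡ positive (gap (Y t) (X t))
  gap-sym t = cong positive (+-comm (lo (X t) ∸ hi (Y t)) _)

¬T⇒≡false : ∀ {b} → ¬ T b → b ≡ false
¬T⇒≡false {false} _  = refl
¬T⇒≡false {true}  ¬t = contradiction tt ¬t

-- The complement of the intersection graph, given by a Boolean test that the machine can evaluate.
disjointnessGraph : ∀ {N} → (Fin N → 3TrackInterval) → Graph
disjointnessGraph {N} F = record
  { order      = N
  ; adj        = λ u v → disjoint (F u) (F v)
  ; adj-sym    = λ u v → disjoint-sym (F u) (F v)
  ; adj-irrefl = λ u → ¬T⇒≡false
      (intersect⇒¬disjoint (F u) (F u) (meet {F u} {F u} zero (lo≤hi (F u zero)) (lo≤hi (F u zero))))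
  }

disjointnessGraph-representation : ∀ {N} (F : Fin N → 3TrackInterval) →
  Is3TrackRepresentation (complement (disjointnessGraph F)) F
disjointnessGraph-representation F u v with u Fin.≟ v
... | yes u≡v = mk⇔ (λ ()) (λ (u≢v , _) → contradiction u≡v u≢v)
... | no  u≢v = mk⇔
  (λ t → u≢v , ¬disjoint⇒intersect {F u} {F v} (¬T {disjoint (F u) (F v)} t))
  (λ (_ , x) → T-not-≡ .Equivalence.from (¬T⇒≡false (intersect⇒¬disjoint (F u) (F v) x)))
  where
  ¬T : ∀ {b} → T (not b) → ¬ T b
  ¬T {true} ()
  ¬T {false} _ ()

-- Brings the conjunction into the arithmetic form of `adjacencyExpr`.
bit-disjoint : ∀ X Y → bit (disjoint X Y) ≡
  (sgn (gap (X zero) (Y zero)) +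
   (sgn (gap (X (suc zero)) (Y (suc zero))) +
    sgn (gap (X (suc (suc zero))) (Y (suc (suc zero)))))) ∸ 2
bit-disjoint X Y = all3 (gap (X zero) (Y zero)) (gap (X (suc zero)) (Y (suc zero)))
  (gap (X (suc (suc zero))) (Y (suc (suc zero))))
  where
  all3 : ∀ a b c → bit (positive a ∧ (positive b ∧ positive c)) ≡ (sgn a + (sgn b + sgn c)) ∸ 2
  all3 zero    zero    zero    = refl
  all3 zero    zero    (suc c) rewrite 0∸n≡0 c = refl
  all3 zero    (suc b) zero    rewrite 0∸n≡0 b = refl
  all3 zero    (suc b) (suc c) rewrite 0∸n≡0 b | 0∸n≡0 c = refl
  all3 (suc a) zero    zero    rewrite 0∸n≡0 a = refl
  all3 (suc a) zero    (suc c) rewrite 0∸n≡0 a | 0∸n≡0 c = refl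
  all3 (suc a) (suc b) zero    rewrite 0∸n≡0 a | 0∸n≡0 b = refl
  all3 (suc a) (suc b) (suc c) rewrite 0∸n≡0 a | 0∸n≡0 b | 0∸n≡0 c = refl

-- Lists produced by loops and by tabulation

collect-suc : ∀ {A : Set} (g : ℕ → List A) n → collect g (suc n) ≡ g 0 ++ collect (g ∘ suc) n
collect-suc g zero    = sym (++-identityʳ (g 0))
collect-suc g (suc n) = trans (cong (_++ g (suc n)) (collect-suc g n)) (++-assoc (g 0) _ _)

-- A loop's list unfolds at its end and a tabulation at its front; `collect-suc` bridges the two.
concat-tabulate : ∀ {A : Set} {n} (h : Fin n → List A) (g : ℕ → List A) →
  (∀ i → h i ≡ g (toℕ i)) → concat (tabulate h) ≡ collect g n
concat-tabulate {n = zero}  h g eq = refl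
concat-tabulate {n = suc n} h g eq = trans
  (cong₂ _++_ (eq zero) (concat-tabulate (h ∘ suc) (g ∘ suc) (eq ∘ suc)))
  (sym (collect-suc g n))

concatMap-allFin : ∀ {A : Set} {n} (h : Fin n → List A) (g : ℕ → List A) →
  (∀ i → h i ≡ g (toℕ i)) → concatMap h (allFin n) ≡ collect g n
concatMap-allFin h g eq = trans (cong concat (map-tabulate id h)) (concat-tabulate h g eq)

map-allFin : ∀ {A : Set} {n} (h : Fin n → A) (g : ℕ → A) →
  (∀ i → h i ≡ g (toℕ i)) → map h (allFin n) ≡ collect ([_] ∘ g) n
map-allFin {n = n} h g eq = trans
  (trans (sym (concatMap-pure (map h (allFin n)))) (concatMap-map [_] h (allFin n)))
  (concatMap-allFin ([_] ∘ h) ([_] ∘ g) (cong [_] ∘ eq))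

cells-tabulate : ∀ {n} (h : Fin n → ℕ) i → cells (tabulate h) (toℕ i) ≡ h i
cells-tabulate h zero    = refl
cells-tabulate h (suc i) = cells-tabulate (h ∘ suc) i

-- Row-major addressing, used both for the adjacency matrix and for the table with its six cells per
-- entry.
cells-concat-tabulate : ∀ {n} (h : Fin n → List ℕ) {r} → (∀ i → length (h i) ≡ r) →
  ∀ i {c} → c < r → cells (concat (tabulate h)) (c + toℕ i * r) ≡ cells (h i) c
cells-concat-tabulate h {r} |h| zero {c} c<r = trans
  (cong (cells (concat (tabulate h))) (+-identityʳ c))
  (cells-++ˡ (h zero) (subst (c <_) (sym (|h| zero)) c<r))
cells-concat-tabulate h {r} |h| (suc i) {c} c<r = trans
  (cong (cells (concat (tabulate h))) shift)
  (trans (cells-++ʳ (h zero) (c + toℕ i * r))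
         (cells-concat-tabulate (h ∘ suc) (|h| ∘ suc) i c<r))
  where
  shift : c + (r + toℕ i * r) ≡ length (h zero) + (c + toℕ i * r)
  shift = trans (x∙yz≈y∙xz +-commutativeSemigroup c r (toℕ i * r))
                (cong (_+ (c + toℕ i * r)) (sym (|h| zero)))

length-concat-tabulate : ∀ {n} (h : Fin n → List ℕ) {r} → (∀ i → length (h i) ≡ r) →
  length (concat (tabulate h)) ≡ n * r
length-concat-tabulate {zero}  h |h| = refl
length-concat-tabulate {suc n} h |h| = trans (length-++ (h zero))
  (cong₂ _+_ (|h| zero) (length-concat-tabulate (h ∘ suc) (|h| ∘ suc)))

-- Intersections and disjointness of the constructed intervals

≤-hi-span : ∀ l h → h ≤ hi (span l h)
≤-hi-span l h = m≤n+m∸n h l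

hi-span : ∀ {l h} → l ≤ h → hi (span l h) ≡ h
hi-span = m+[n∸m]≡n

module Geometry (k n : ℕ) where

  open Layout k n

  private
    offset-low : ∀ {x} → x ≤ n → 1 + x < width
    offset-low {x} x≤n = s<s (s≤s (≤-trans x≤n (m≤m+n n n)))

    offset-high : ∀ {x} → x ≤ n → 1 + (n + x) < width
    offset-high x≤n = s<s (s≤s (+-monoʳ-≤ n x≤n))

    offset-< : ∀ p {o} → o < width → base p + o < base (suc p)
    offset-< p o< = <-≤-trans (+-monoʳ-< (base p) o<) (≤-reflexive (+-comm (base p) width))

    base-mono : ∀ {p q} → p ≤ q → base p ≤ base q
    base-mono = *-monoˡ-≤ width

    shift : ∀ p {o o′} → o ≤ o′ → base p + o ≤ base p + o′
    shift p = +-monoʳ-≤ (base p)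

    shift-< : ∀ p {o o′} → o < o′ → base p + o < base p + o′
    shift-< p = +-monoʳ-< (base p)

    even<odd : ∀ {i j} → i < j → suc (i * 2) < j * 2
    even<odd {i} {j} i<j = *-monoˡ-≤ 2 {suc i} {j} i<j

    n∸≤ : ∀ x → n ∸ x ≤ n
    n∸≤ x = m∸n≤m n x

  choice-above : ∀ p x t → base p < lo (intervals (choice p x) t)
  choice-above p x zero             = m<m+n (base p) z<s
  choice-above p x (suc zero)       = m<m+n (base p) z<s
  choice-above p x (suc (suc zero)) = m<m+n (base p) z<s

  private
    hi₁ : ∀ p {x} → x ≤ n → hi (intervals (choice p x) zero) ≡ base p + (1 + (n + (n ∸ x)))
    hi₁ p {x} x≤n = hi-span (shift p (s≤s (≤-trans x≤n (m≤m+n n (n ∸ x)))))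

    hi₂ : ∀ p {x} → x ≤ n → hi (intervals (choice p x) (suc zero)) ≡ base p + (1 + (n + x))
    hi₂ p {x} x≤n = hi-span (shift p (s≤s (m≤n+m x n)))

    hi₃ : ∀ p {x} → x ≤ n → hi (intervals (choice p x) (suc (suc zero))) ≡ base p + (1 + (n + x))
    hi₃ p {x} x≤n = hi-span (shift p (s≤s (≤-trans (n∸≤ x) (m≤m+n n x))))

  choice-below : ∀ p {x} → x ≤ n → ∀ t → hi (intervals (choice p x) t) < base (suc p)
  choice-below p {x} x≤n zero =
    ≤-<-trans (≤-reflexive (hi₁ p x≤n)) (offset-< p (offset-high (n∸≤ x)))
  choice-below p x≤n (suc zero)       = ≤-<-trans (≤-reflexive (hi₂ p x≤n)) (offset-< p (offset-high x≤n))
  choice-below p x≤n (suc (suc zero)) = ≤-<-trans (≤-reflexive (hi₃ p x≤n)) (offset-< p (offset-high x≤n))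

  private
    choice-lo≤ : ∀ p {x} → x ≤ n → ∀ t → lo (intervals (choice p x) t) ≤ base (suc p)
    choice-lo≤ p {x} x≤n t =
      ≤-trans (lo≤hi (intervals (choice p x) t)) (<⇒≤ (choice-below p x≤n t))

    ≤choice-hi : ∀ p x t → base p ≤ hi (intervals (choice p x) t)
    ≤choice-hi p x t = ≤-trans (<⇒≤ (choice-above p x t)) (lo≤hi (intervals (choice p x) t))

  -- Earlier groups are met by the prefix on the first track, later ones by the suffix on the
  -- second.
  force-choice-meet : ∀ {b p q y} → q ≢ p → q < k * 2 → y ≤ n →
    Intersect (intervals (force b p)) (intervals (choice q y))
  force-choice-meet {b} {p} {q} {y} q≢p q<K y≤n with <-cmp q p
  ... | tri< q<p _ _ = meet {intervals (force b p)} {intervals (choice q y)} zero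
          z≤n (≤-trans (choice-lo≤ q y≤n zero) (base-mono q<p))
  ... | tri≈ _ q≡p _ = contradiction q≡p q≢p
  ... | tri> _ _ p<q = meet {intervals (force b p)} {intervals (choice q y)} (suc zero)
          (≤-trans (base-mono p<q) (≤choice-hi q y (suc zero)))
          (≤-trans (choice-lo≤ q y≤n (suc zero))
            (≤-trans (base-mono q<K) (≤-hi-span (base (suc p)) end)))

  -- The third track handles groups up to 2j, the first those from 2j + 1 on. In these two groups
  -- the thresholds use the reversed coordinate n ∸ y: they ask for n ∸ z (2j) ≤ w < n ∸ z (2j + 1).
  ordered-choice-meet : ∀ {j w q y} → j < k → w < n → q < k * 2 → y ≤ n →
    (q ≡ j * 2 → n ∸ y ≤ w) → (q ≡ suc (j * 2) → w < n ∸ y) →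
    Intersect (intervals (ordered j w)) (intervals (choice q y))
  ordered-choice-meet {j} {w} {q} {y} j<k w<n q<K y≤n even odd = go (<-cmp q (j * 2))
    where
    X = intervals (ordered j w)
    Y = intervals (choice q y)
    end-≥ : ∀ t → lo (Y t) ≤ end
    end-≥ t = ≤-trans (choice-lo≤ q y≤n t) (base-mono q<K)
    above : base (suc (j * 2)) + (2 + (n + w)) ≤ hi (Y zero) → Intersect X Y
    above le = meet {X} {Y} zero le
      (≤-trans (end-≥ zero) (≤-hi-span (base (suc (j * 2)) + (2 + (n + w))) end))
    go : _ → Intersect X Y
    go (tri< q<2j _ _) = meet {X} {Y} (suc (suc zero)) z≤n
      (≤-trans (choice-lo≤ q y≤n (suc (suc zero))) (≤-trans (base-mono q<2j) (m≤m+n _ (1 + w))))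
    go (tri≈ _ refl _) = meet {X} {Y} (suc (suc zero)) z≤n (shift q (s≤s (even refl)))
    go (tri> _ _ q>2j) with m≤n⇒m<n∨m≡n q>2j
    ... | inj₂ refl = above (≤-trans
                       (shift q (s≤s (subst (_≤ n + (n ∸ y)) (+-suc n w) (+-monoʳ-≤ n (odd refl)))))
                       (≤-hi-span (base q + (1 + y)) _))
    ... | inj₁ q>2j+1 = above (≤-trans (<⇒≤ (offset-< (suc (j * 2)) (s<s (s<s (+-monoʳ-< n w<n)))))
                       (≤-trans (base-mono q>2j+1) (≤choice-hi q y zero)))

  -- The three tracks share out the groups: up to 2i on the first, from 2i + 1 to 2j on the second,
  -- and from 2j + 1 on the third, with a threshold at each of these four boundary groups.
  nonEdge-choice-meet : ∀ {i j a b q y} → i < j → j < k → a < n → b < n → q < k * 2 → y ≤ n →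
    (q ≡ i * 2 → y ≤ a) → (q ≡ suc (i * 2) → a ≤ y) →
    (q ≡ j * 2 → y ≤ b) → (q ≡ suc (j * 2) → b ≤ y) →
    Intersect (intervals (nonEdge i j a b)) (intervals (choice q y))
  nonEdge-choice-meet {i} {j} {a} {b} {q} {y} i<j j<k a<n b<n q<K y≤n ≤a ≥a ≤b ≥b =
    go (<-cmp q (i * 2)) (<-cmp q (j * 2))
    where
    X = intervals (nonEdge i j a b)
    Y = intervals (choice q y)
    first : lo (Y zero) ≤ base (i * 2) + (1 + a) → Intersect X Y
    first = meet {X} {Y} zero z≤n
    second : base (suc (i * 2)) + (1 + (n + a)) ≤ hi (Y (suc zero)) →
             lo (Y (suc zero)) ≤ base (j * 2) + (1 + b) → Intersect X Y
    second l≤ ≤h = meet {X} {Y} (suc zero) l≤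
      (≤-trans ≤h (≤-hi-span (base (suc (i * 2)) + (1 + (n + a))) _))
    third : base (suc (j * 2)) + (1 + (n + b)) ≤ hi (Y (suc (suc zero))) → Intersect X Y
    third l≤ = meet {X} {Y} (suc (suc zero)) l≤
      (≤-trans (choice-lo≤ q y≤n (suc (suc zero)))
        (≤-trans (base-mono q<K) (≤-hi-span (base (suc (j * 2)) + (1 + (n + b))) end)))
    second-lo : suc (i * 2) < q → base (suc (i * 2)) + (1 + (n + a)) ≤ hi (Y (suc zero))
    second-lo lt = ≤-trans (<⇒≤ (offset-< (suc (i * 2)) (offset-high (<⇒≤ a<n))))
      (≤-trans (base-mono lt) (≤choice-hi q y (suc zero)))
    second-hi : q < j * 2 → lo (Y (suc zero)) ≤ base (j * 2) + (1 + b)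
    second-hi lt = ≤-trans (choice-lo≤ q y≤n (suc zero)) (≤-trans (base-mono lt) (m≤m+n _ _))
    go : _ → _ → Intersect X Y
    go (tri< q<2i _ _) _ = first (≤-trans (choice-lo≤ q y≤n zero) (≤-trans (base-mono q<2i) (m≤m+n _ _)))
    go (tri≈ _ refl _) _ = first (shift q (s≤s (≤a refl)))
    go (tri> _ _ q>2i) (tri< q<2j _ _) with m≤n⇒m<n∨m≡n q>2i
    ... | inj₂ refl   = second
      (≤-trans (shift q (s≤s (+-monoʳ-≤ n (≥a refl)))) (≤-hi-span (base q + (1 + y)) _))
      (second-hi q<2j)
    ... | inj₁ q>2i+1 = second (second-lo q>2i+1) (second-hi q<2j)
    go (tri> _ _ q>2i) (tri≈ _ refl _) =
      second (second-lo (even<odd i<j)) (shift q (s≤s (≤b refl)))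
    go (tri> _ _ q>2i) (tri> _ _ q>2j) with m≤n⇒m<n∨m≡n q>2j
    ... | inj₂ refl   = third (≤-trans (shift q (s≤s (+-monoʳ-≤ n (≥b refl))))
      (≤-hi-span (base q + (1 + (n ∸ y))) _))
    ... | inj₁ q>2j+1 = third (≤-trans (<⇒≤ (offset-< (suc (j * 2)) (offset-high (<⇒≤ b<n))))
      (≤-trans (base-mono q>2j+1) (≤choice-hi q y (suc (suc zero)))))

  force-choice-disjoint : ∀ b {p x} → p < k * 2 → x ≤ n →
    T (disjoint (intervals (force b p)) (intervals (choice p x)))
  force-choice-disjoint b {p} {x} p<K x≤n =
    apart-disjoint (intervals (force b p)) (intervals (choice p x)) λ
      { zero             → inj₁ (choice-above p x zero)
      ; (suc zero)       → inj₂ (choice-below p x≤n (suc zero))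
      ; (suc (suc zero)) → inj₁ (≤-trans (s≤s z≤n) (choice-above p x (suc (suc zero)))) }

  choice-choice-disjoint : ∀ {p q x y} → p ≢ q → x ≤ n → y ≤ n →
    T (disjoint (intervals (choice p x)) (intervals (choice q y)))
  choice-choice-disjoint {p} {q} {x} {y} p≢q x≤n y≤n =
    apart-disjoint (intervals (choice p x)) (intervals (choice q y)) λ t → go t (<-cmp p q)
    where
    before : ∀ {p q x} y → p < q → x ≤ n → ∀ t →
      hi (intervals (choice p x) t) < lo (intervals (choice q y) t)
    before {p} {q} y p<q x≤n t =
      <-trans (<-≤-trans (choice-below p x≤n t) (base-mono p<q)) (choice-above q y t)
    go : ∀ t → _ → _
    go t (tri< p<q _ _) = inj₁ (before y p<q x≤n t)
    go t (tri≈ _ p≡q _) = contradiction p≡q p≢q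
    go t (tri> _ _ q<p) = inj₂ (before x q<p y≤n t)

  ordered-even-disjoint : ∀ {j w y} → y ≤ n → w < n ∸ y →
    T (disjoint (intervals (ordered j w)) (intervals (choice (j * 2) y)))
  ordered-even-disjoint {j} {w} {y} y≤n w<n∸y =
    apart-disjoint (intervals (ordered j w)) (intervals (choice (j * 2) y)) λ
      { zero             → inj₂ (<-≤-trans (choice-below (j * 2) y≤n zero) (m≤m+n _ _))
      ; (suc zero)       → inj₁ (≤-trans (s≤s z≤n) (choice-above (j * 2) y (suc zero)))
      ; (suc (suc zero)) → inj₁ (shift-< (j * 2) (s<s w<n∸y)) }

  ordered-odd-disjoint : ∀ {j w y} → y ≤ n → w < n → n ∸ y ≤ w →
    T (disjoint (intervals (ordered j w)) (intervals (choice (suc (j * 2)) y)))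
  ordered-odd-disjoint {j} {w} {y} y≤n w<n n∸y≤w =
    apart-disjoint (intervals (ordered j w)) (intervals (choice q y)) λ
      -- The suffix starts at offset 2 + (n + w) rather than 1 + (n + w), so n ∸ y = w already
      -- separates.
      { zero             → inj₂ (≤-<-trans (≤-reflexive (hi₁ q y≤n)) (shift-< q (s<s (s≤s (+-monoʳ-≤ n n∸y≤w)))))
      ; (suc zero)       → inj₁ (≤-trans (s≤s z≤n) (choice-above q y (suc zero)))
      ; (suc (suc zero)) → inj₁ (<-trans (offset-< (j * 2) (offset-low (<⇒≤ w<n)))
                                          (choice-above q y (suc (suc zero)))) }
    where q = suc (j * 2)

  -- Conversely, in each of the four boundary groups a choice on the wrong side of its threshold is
  -- missed on all three tracks.
  module _ {i j a b} (i<j : i < j) (j<k : j < k) (a<n : a < n) (b<n : b < n) where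

    private
      X = intervals (nonEdge i j a b)

      2i+1<2j : suc (i * 2) < j * 2
      2i+1<2j = even<odd i<j

      first-< : hi (X zero) < base (suc (i * 2))
      first-< = offset-< (i * 2) (offset-low (<⇒≤ a<n))

      second-≡ : hi (X (suc zero)) ≡ base (j * 2) + (1 + b)
      second-≡ = hi-span (≤-trans (<⇒≤ (offset-< (suc (i * 2)) (offset-high (<⇒≤ a<n))))
        (≤-trans (base-mono 2i+1<2j) (m≤m+n _ _)))

      third-≥ : ∀ {p} → p ≤ suc (j * 2) → base p ≤ lo (X (suc (suc zero)))
      third-≥ p≤ = ≤-trans (base-mono p≤) (m≤m+n _ _)

    nonEdge-first-even-disjoint : ∀ {y} → y ≤ n → a < y → T (disjoint X (intervals (choice (i * 2) y)))
    nonEdge-first-even-disjoint {y} y≤n a<y = apart-disjoint X (intervals (choice (i * 2) y)) λ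
      { zero             → inj₁ (shift-< (i * 2) (s<s a<y))
      ; (suc zero)       → inj₂ (<-≤-trans (choice-below (i * 2) y≤n (suc zero)) (m≤m+n _ _))
      ; (suc (suc zero)) → inj₂ (<-≤-trans (choice-below (i * 2) y≤n (suc (suc zero)))
                                           (third-≥ (<⇒≤ (≤-trans 2i+1<2j (n≤1+n _))))) }

    nonEdge-first-odd-disjoint : ∀ {y} → y ≤ n → y < a → T (disjoint X (intervals (choice (suc (i * 2)) y)))
    nonEdge-first-odd-disjoint {y} y≤n y<a = apart-disjoint X (intervals (choice p y)) λ
      { zero             → inj₁ (<-trans first-< (choice-above p y zero))
      ; (suc zero)       → inj₂ (≤-<-trans (≤-reflexive (hi₂ p y≤n)) (shift-< p (s<s (+-monoʳ-< n y<a))))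
      ; (suc (suc zero)) → inj₂ (<-≤-trans (choice-below p y≤n (suc (suc zero)))
                                           (third-≥ (≤-trans 2i+1<2j (n≤1+n _)))) }
      where p = suc (i * 2)

    nonEdge-second-even-disjoint : ∀ {y} → y ≤ n → b < y → T (disjoint X (intervals (choice (j * 2) y)))
    nonEdge-second-even-disjoint {y} y≤n b<y = apart-disjoint X (intervals (choice (j * 2) y)) λ
      { zero             → inj₁ (<-trans (<-≤-trans first-< (base-mono (<⇒≤ 2i+1<2j)))
                                      (choice-above (j * 2) y zero))
      ; (suc zero)       → inj₁ (≤-<-trans (≤-reflexive second-≡) (shift-< (j * 2) (s<s b<y)))
      ; (suc (suc zero)) → inj₂ (<-≤-trans (choice-below (j * 2) y≤n (suc (suc zero))) (third-≥ ≤-refl)) }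

    nonEdge-second-odd-disjoint : ∀ {y} → y ≤ n → y < b → T (disjoint X (intervals (choice (suc (j * 2)) y)))
    nonEdge-second-odd-disjoint {y} y≤n y<b = apart-disjoint X (intervals (choice q y)) λ
      { zero             → inj₁ (<-trans (<-≤-trans first-< (base-mono (≤-trans (<⇒≤ 2i+1<2j) (n≤1+n _))))
                                      (choice-above q y zero))
      ; (suc zero)       → inj₁ (≤-<-trans (≤-reflexive second-≡)
                             (<-trans (offset-< (j * 2) (offset-low (<⇒≤ b<n))) (choice-above q y (suc zero))))
      ; (suc (suc zero)) → inj₂ (≤-<-trans (≤-reflexive (hi₃ q y≤n)) (shift-< q (s<s (+-monoʳ-< n y<b)))) }
      where q = suc (j * 2)

-- Subsets of a finite set as images

image : ∀ {m n} → (Fin m → Fin n) → Subset n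
image {zero}  f = ⊥
image {suc m} f = ⁅ f zero ⁆ ∪ image (f ∘ suc)

∈-image⁺ : ∀ {m n} (f : Fin m → Fin n) i → f i ∈ image f
∈-image⁺ f zero    = x∈p∪q⁺ (inj₁ (x∈⁅x⁆ (f zero)))
∈-image⁺ f (suc i) = x∈p∪q⁺ {p = ⁅ f zero ⁆} (inj₂ (∈-image⁺ (f ∘ suc) i))

∈-image⁻ : ∀ {m n} (f : Fin m → Fin n) {x} → x ∈ image f → ∃[ i ] x ≡ f i
∈-image⁻ {zero}  f x∈ = contradiction x∈ ∉⊥
∈-image⁻ {suc m} f x∈ with x∈p∪q⁻ ⁅ f zero ⁆ (image (f ∘ suc)) x∈
... | inj₁ x∈₀ = zero , x∈⁅y⁆⇒x≡y (f zero) x∈₀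
... | inj₂ x∈ₛ with ∈-image⁻ (f ∘ suc) x∈ₛ
...   | i , eq = suc i , eq

∣⁅x⁆∪p∣≤ : ∀ {n} x (p : Subset n) → ∣ ⁅ x ⁆ ∪ p ∣ ≤ suc ∣ p ∣
∣⁅x⁆∪p∣≤ zero    (outside Vec.∷ p) rewrite ∪-identityˡ p = ≤-refl
∣⁅x⁆∪p∣≤ zero    (inside  Vec.∷ p) rewrite ∪-identityˡ p = n≤1+n _
∣⁅x⁆∪p∣≤ (suc x) (outside Vec.∷ p) = ∣⁅x⁆∪p∣≤ x p
∣⁅x⁆∪p∣≤ (suc x) (inside  Vec.∷ p) = s≤s (∣⁅x⁆∪p∣≤ x p)

-- The new element adds at most one to the size and, by injectivity, makes the inclusion of the rest
-- strict.
∣image∣ : ∀ {m n} (f : Fin m → Fin n) → (∀ {i j} → f i ≡ f j → i ≡ j) → ∣ image f ∣ ≡ m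
∣image∣ {zero}  {n} f inj = ∣⊥∣≡0 n
∣image∣ {suc m} f inj = ≤-antisym
  (≤-trans (∣⁅x⁆∪p∣≤ (f zero) rest) (s≤s (≤-reflexive |rest|)))
  (subst (_< ∣ image f ∣) |rest|
    (p⊂q⇒∣p∣<∣q∣ (q⊆p∪q ⁅ f zero ⁆ rest , f zero , ∈-image⁺ f zero , f₀∉rest)))
  where
  rest = image (f ∘ suc)
  |rest| = ∣image∣ (f ∘ suc) (Fin.suc-injective ∘ inj)
  f₀∉rest : f zero ∉ rest
  f₀∉rest f₀∈ with ∈-image⁻ (f ∘ suc) f₀∈
  ... | i , eq with () ← inj eq

-- If `d` lay outside, the image would be a proper subset of `D` of the same size.
full-image : ∀ {m n} (f : Fin m → Fin n) → (∀ {i j} → f i ≡ f j → i ≡ j) →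
  ∀ {D} → ∣ D ∣ ≡ m → (∀ i → f i ∈ D) → ∀ {d} → d ∈ D → ∃[ i ] d ≡ f i
full-image f inj {D} |D| f∈D {d} d∈D with d ∈? image f
... | yes d∈ = ∈-image⁻ f d∈
... | no  d∉ = contradiction (trans (∣image∣ f inj) (sym |D|))
  (<⇒≢ (p⊂q⇒∣p∣<∣q∣ ((λ x∈ → subst (_∈ D) (sym (proj₂ (∈-image⁻ f x∈))) (f∈D _)) , d , d∈D , d∉)))

enumerate : ∀ {m n} (D : Subset n) → ∣ D ∣ ≡ m →
  ∃[ f ] ((∀ {i j : Fin m} → f i ≡ f j → i ≡ j) × (∀ i → f i ∈ D))
enumerate Vec.[]          refl = (λ ()) , (λ {i} → contradiction i Fin.¬Fin0) , (λ ())
enumerate (outside Vec.∷ D) eq with enumerate D eq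
... | f , inj , f∈D = suc ∘ f , inj ∘ Fin.suc-injective , Vec.there ∘ f∈D
enumerate {suc m} (inside Vec.∷ D) eq with enumerate D (suc-injective eq)
... | f , inj , f∈D = g , g-inj _ _ , g∈
  where
  g : Fin (suc m) → Fin _
  g zero    = zero
  g (suc i) = suc (f i)
  g-inj : ∀ i j → g i ≡ g j → i ≡ j
  g-inj zero    zero    _  = refl
  g-inj (suc i) (suc j) eq = cong suc (inj (Fin.suc-injective eq))
  g∈ : ∀ i → g i ∈ inside Vec.∷ D
  g∈ zero    = Vec.here
  g∈ (suc i) = Vec.there (f∈D i)

-- Membership in collected lists

∈-collect⁺ : ∀ {A : Set} {x : A} g {i n} → i < n → x ∈ˡ g i → x ∈ˡ collect g n
∈-collect⁺ g {i} {suc n} i<n x∈ with m≤n⇒m<n∨m≡n i<n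
... | inj₁ (s≤s i<n′) = ∈-++⁺ˡ (∈-collect⁺ g i<n′ x∈)
... | inj₂ refl       = ∈-++⁺ʳ (collect g n) x∈

∈-collect⁻ : ∀ {A : Set} {x : A} g n → x ∈ˡ collect g n → ∃[ i ] (i < n × x ∈ˡ g i)
∈-collect⁻ g (suc n) x∈ with ∈-++⁻ (collect g n) x∈
... | inj₂ x∈ₙ = n , ≤-refl , x∈ₙ
... | inj₁ x∈′ with ∈-collect⁻ g n x∈′
...   | i , i<n , x∈ᵢ = i , m<n⇒m<1+n i<n , x∈ᵢ

∈-unlessNonZero⁻ : ∀ {A : Set} {x y : A} c → x ∈ˡ unlessNonZero c y → c ≡ 0 × x ≡ y
∈-unlessNonZero⁻ zero (here eq) = refl , eq

-- Dominating sets of the constructed graph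

data EvenOrOdd : ℕ → Set where
  even : ∀ j → EvenOrOdd (j * 2)
  odd  : ∀ j → EvenOrOdd (suc (j * 2))

evenOrOdd : ∀ p → EvenOrOdd p
evenOrOdd zero = even zero
evenOrOdd (suc p) with evenOrOdd p
... | even j = odd j
... | odd j  = even (suc j)

even-< : ∀ {j k} → j < k → j * 2 < k * 2
even-< = *-monoˡ-< 2

odd-< : ∀ {j k} → j < k → suc (j * 2) < k * 2
odd-< {j} j<k = *-monoˡ-≤ 2 {suc j} j<k

half-even : ∀ j → ⌊ j * 2 /2⌋ ≡ j
half-even zero    = refl
half-even (suc j) = cong suc (half-even j)

half-odd : ∀ j → ⌊ suc (j * 2) /2⌋ ≡ j
half-odd zero    = refl
half-odd (suc j) = cong suc (half-odd j)

module Correspondence (k n : ℕ) (bits : List ℕ) where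

  open Layout k n
  open Geometry k n
  open Table k n bits

  -- Characterises the members of `table`, so that nodes can be treated by cases instead of by list
  -- position.
  data Valid : Kind → Set where
    force   : ∀ {b p} → p < k * 2 → Valid (force b p)
    choice  : ∀ {p x} → p < k * 2 → x < n → Valid (choice p x)
    ordered : ∀ {j w} → j < k → w < n → Valid (ordered j w)
    nonEdge : ∀ {i j a b} → i < j → j < k → a < n → b < n → entry a b ≡ 0 → Valid (nonEdge i j a b)

  table-sound : ∀ {κ} → κ ∈ˡ table → Valid κ
  table-sound κ∈ with ∈-collect⁻ _ k κ∈
  ... | j , j<k , κ∈₁ with ∈-++⁻ (selectors j) κ∈₁
  ...   | inj₁ (here refl)                         = force (even-< j<k)
  ...   | inj₁ (there (here refl))                 = force (even-< j<k)
  ...   | inj₁ (there (there (here refl)))         = force (odd-< j<k)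
  ...   | inj₁ (there (there (there (here refl)))) = force (odd-< j<k)
  ...   | inj₂ κ∈₂ with ∈-++⁻ (collect (choices j) n) κ∈₂
  ...     | inj₁ κ∈₃ with ∈-collect⁻ _ n κ∈₃
  ...       | x , x<n , here refl                 = choice (even-< j<k) x<n
  ...       | x , x<n , there (here refl)         = choice (odd-< j<k) x<n
  ...       | x , x<n , there (there (here refl)) = ordered j<k x<n
  table-sound κ∈ | j , j<k , κ∈₁ | inj₂ κ∈₂ | inj₂ κ∈₃ with ∈-collect⁻ _ j κ∈₃
  ... | i , i<j , κ∈₄ with ∈-collect⁻ _ n κ∈₄
  ...   | a , a<n , κ∈₅ with ∈-collect⁻ _ n κ∈₅
  ...     | b , b<n , κ∈₆ with ∈-unlessNonZero⁻ (entry a b) κ∈₆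
  ...       | eq , refl = nonEdge i<j j<k a<n b<n eq

  private
    in-row : ∀ {κ j} → j < k →
      κ ∈ˡ selectors j ++ collect (choices j) n ++ collect (nonEdges j) j → κ ∈ˡ table
    in-row = ∈-collect⁺ _

    in-selectors : ∀ {κ j} → j < k → κ ∈ˡ selectors j → κ ∈ˡ table
    in-selectors j<k = in-row j<k ∘ ∈-++⁺ˡ

    in-choices : ∀ {κ j x} → j < k → x < n → κ ∈ˡ choices j x → κ ∈ˡ table
    in-choices {j = j} j<k x<n κ∈ =
      in-row j<k (∈-++⁺ʳ (selectors j) (∈-++⁺ˡ (∈-collect⁺ (choices j) x<n κ∈)))

    even-<⁻ : ∀ j → j * 2 < k * 2 → j < k
    even-<⁻ j = *-cancelʳ-< 2 j k

    odd-<⁻ : ∀ j → suc (j * 2) < k * 2 → j < k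
    odd-<⁻ j = even-<⁻ j ∘ <-trans (n<1+n (j * 2))

  table-complete : ∀ {κ} → Valid κ → κ ∈ˡ table
  table-complete (force {b} {p} p<K) with evenOrOdd p | b
  ... | even j | false = in-selectors {j = j} (even-<⁻ j p<K) (here refl)
  ... | even j | true  = in-selectors {j = j} (even-<⁻ j p<K) (there (here refl))
  ... | odd j  | false = in-selectors {j = j} (odd-<⁻ j p<K) (there (there (here refl)))
  ... | odd j  | true  = in-selectors {j = j} (odd-<⁻ j p<K) (there (there (there (here refl))))
  table-complete (choice {p} p<K x<n) with evenOrOdd p
  ... | even j = in-choices {j = j} (even-<⁻ j p<K) x<n (here refl)
  ... | odd j  = in-choices {j = j} (odd-<⁻ j p<K) x<n (there (here refl))
  table-complete (ordered j<k w<n) = in-choices j<k w<n (there (there (here refl)))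
  table-complete (nonEdge {i} {j} {a} {b} i<j j<k a<n b<n eq) =
    in-row j<k (∈-++⁺ʳ (selectors j) (∈-++⁺ʳ (collect (choices j) n)
      (∈-collect⁺ (nonEdges j) i<j (∈-collect⁺ _ a<n (∈-collect⁺ _ b<n last)))))
    where
    last : nonEdge i j a b ∈ˡ unlessNonZero (entry a b) (nonEdge i j a b)
    last rewrite eq = here refl

  Node : Set
  Node = Fin (length table)

  kind : Node → Kind
  kind = lookup table

  kind-valid : ∀ v → Valid (kind v)
  kind-valid v = table-sound (∈-lookup v)

  node : ∀ {κ} → Valid κ → Node
  node κ✓ = index (table-complete κ✓)

  kind-node : ∀ {κ} (κ✓ : Valid κ) → kind (node κ✓) ≡ κ
  kind-node κ✓ = sym (lookup-index (table-complete κ✓))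

  H : Graph
  H = disjointnessGraph (intervals ∘ kind)

  -- A k-clique listed as a sequence and phrased in raw matrix entries, as the middle link between
  -- cliques and dominating sets.
  record Solution : Set where
    field
      vertex   : ℕ → ℕ
      vertex<n : ∀ {j} → j < k → vertex j < n
      linked   : ∀ {i j} → i < j → j < k → entry (vertex i) (vertex j) ≢ 0

  -- The 0 for the last two kinds is a default; the function serves to tell choices and force
  -- intervals of different groups apart.
  group : Kind → ℕ
  group (force _ p)       = p
  group (choice p _)      = p
  group (ordered _ _)     = 0
  group (nonEdge _ _ _ _) = 0

  module _ (S : Solution) where

    open Solution S

    private
      -- Groups 2j and 2j + 1 receive the same vertex.
      z : ℕ → ℕ
      z p = vertex ⌊ p /2⌋

      z<n : ∀ {p} → p < k * 2 → z p < n
      z<n {p} p<K with evenOrOdd p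
      ... | even j = subst (λ i → vertex i < n) (sym (half-even j)) (vertex<n (even-<⁻ j p<K))
      ... | odd j  = subst (λ i → vertex i < n) (sym (half-odd j)) (vertex<n (odd-<⁻ j p<K))

      chosen✓ : ∀ (p : Fin (k * 2)) → Valid (choice (toℕ p) (z (toℕ p)))
      chosen✓ p = choice (Fin.toℕ<n p) (z<n (Fin.toℕ<n p))

      chosen : Fin (k * 2) → Node
      chosen p = node (chosen✓ p)

      chosen-kind : ∀ p → kind (chosen p) ≡ choice (toℕ p) (z (toℕ p))
      chosen-kind p = kind-node (chosen✓ p)

      chosen-injective : ∀ {p q} → chosen p ≡ chosen q → p ≡ q
      chosen-injective {p} {q} eq = Fin.toℕ-injective (cong group
        (trans (sym (chosen-kind p)) (trans (cong kind eq) (chosen-kind q))))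

      D = image chosen

    chosen-size : ∣ D ∣ ≡ k * 2
    chosen-size = ∣image∣ chosen chosen-injective

    private
      dominated : ∀ {v κ p} → kind v ≡ κ → p < k * 2 →
        T (disjoint (intervals κ) (intervals (choice p (z p)))) →
        ∃[ u ] (u ∈ D × Adjacent H v u)
      dominated {v} {κ} {p} refl p<K d = chosen (fromℕ< p<K) , ∈-image⁺ chosen _ ,
        subst (λ κ′ → T (disjoint (intervals κ) (intervals κ′)))
          (sym (trans (chosen-kind _) (cong (λ q → choice q (z q)) (Fin.toℕ-fromℕ< p<K)))) d

      dominated-even : ∀ {v κ j} → kind v ≡ κ → j < k →
        T (disjoint (intervals κ) (intervals (choice (j * 2) (vertex j)))) →
        ∃[ u ] (u ∈ D × Adjacent H v u)
      dominated-even {v} {κ} {j} eq j<k d = dominated eq (even-< j<k)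
        (subst (λ i → T (disjoint (intervals κ) (intervals (choice (j * 2) (vertex i))))) (sym (half-even j)) d)

      dominated-odd : ∀ {v κ j} → kind v ≡ κ → j < k →
        T (disjoint (intervals κ) (intervals (choice (suc (j * 2)) (vertex j)))) →
        ∃[ u ] (u ∈ D × Adjacent H v u)
      dominated-odd {v} {κ} {j} eq j<k d = dominated eq (odd-< j<k)
        (subst (λ i → T (disjoint (intervals κ) (intervals (choice (suc (j * 2)) (vertex i))))) (sym (half-odd j)) d)

      neighbour : ∀ {v κ} → kind v ≡ κ → Valid κ → ∃[ u ] (u ∈ D × Adjacent H v u)
      neighbour eq (force {b} {p} p<K) =
        dominated eq p<K (force-choice-disjoint b p<K (<⇒≤ (z<n p<K)))
      -- A choice is disjoint from the chosen one of another group: group 1 for group 0, and group 0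
      -- otherwise. Group 1 exists because groups come in pairs.
      neighbour eq (choice {zero} p<K x<n) =
        dominated eq 1<K (choice-choice-disjoint {0} {1} (λ ()) (<⇒≤ x<n) (<⇒≤ (z<n 1<K)))
        where 1<K = odd-< {0} (even-<⁻ 0 p<K)
      neighbour eq (choice {suc p} p<K x<n) =
        dominated eq 0<K (choice-choice-disjoint {suc p} {0} (λ ()) (<⇒≤ x<n) (<⇒≤ (z<n 0<K)))
        where 0<K = ≤-trans (s≤s z≤n) p<K
      -- Both groups of the pair carry the same vertex, so on either side of the threshold one of
      -- the two choices is missed.
      neighbour eq (ordered {j} {w} j<k w<n) with n ∸ vertex j ≤? w
      ... | yes ≤w = dominated-odd eq j<k (ordered-odd-disjoint {j} (<⇒≤ (vertex<n j<k)) w<n ≤w)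
      ... | no  ≰w = dominated-even eq j<k (ordered-even-disjoint {j} (<⇒≤ (vertex<n j<k)) (≰⇒> ≰w))
      neighbour eq (nonEdge {i} {j} {a} {b} i<j j<k a<n b<n ab≡0)
        with <-cmp (vertex i) a | <-cmp (vertex j) b
      ... | tri< x<a _ _ | _ = dominated-odd eq (<-trans i<j j<k)
              (nonEdge-first-odd-disjoint i<j j<k a<n b<n (<⇒≤ (vertex<n (<-trans i<j j<k))) x<a)
      ... | tri> _ _ a<x | _ = dominated-even eq (<-trans i<j j<k)
              (nonEdge-first-even-disjoint i<j j<k a<n b<n (<⇒≤ (vertex<n (<-trans i<j j<k))) a<x)
      ... | tri≈ _ _ _ | tri< x<b _ _ = dominated-odd eq j<k
              (nonEdge-second-odd-disjoint i<j j<k a<n b<n (<⇒≤ (vertex<n j<k)) x<b)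
      ... | tri≈ _ _ _ | tri> _ _ b<x = dominated-even eq j<k
              (nonEdge-second-even-disjoint i<j j<k a<n b<n (<⇒≤ (vertex<n j<k)) b<x)
      -- Only a = x i and b = x j for the clique x meets all four thresholds, and such a pair is an
      -- edge.
      ... | tri≈ _ refl _ | tri≈ _ refl _ = contradiction ab≡0 (linked i<j j<k)

    solution⇒dominatingClique : HasDominatingCliqueOfSize H (k * 2)
    solution⇒dominatingClique = D , chosen-size , (λ v → inj₂ (neighbour refl (kind-valid v))) , clique
      where
      clique : IsClique H D
      clique {u} {v} u∈D v∈D u≢v with ∈-image⁻ chosen u∈D | ∈-image⁻ chosen v∈D
      ... | p , refl | q , refl = subst₂ (λ κ κ′ → T (disjoint (intervals κ) (intervals κ′)))
        (sym (chosen-kind p)) (sym (chosen-kind q))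
        (choice-choice-disjoint (λ p≡q → u≢v (cong chosen (Fin.toℕ-injective p≡q)))
          (<⇒≤ (z<n (Fin.toℕ<n p))) (<⇒≤ (z<n (Fin.toℕ<n q))))

  -- Both problems share this direction: it starts from domination and the size of `D`.
  module _ (D : Subset (length table)) (|D| : ∣ D ∣ ≡ k * 2) (dominating : IsDominating H D) where

    private
      -- A force interval meets every force and `nonEdge` interval at position 0 of the first track,
      -- every `ordered` one at position 0 of the third, and the choices of other groups.
      force-neighbour : ∀ {b p u} → T (disjoint (intervals (force b p)) (intervals (kind u))) →
        ∃[ x ] (kind u ≡ choice p x × x < n)
      force-neighbour {b} {p} {u} d with kind u | kind-valid u
      ... | force b′ q | _ = contradiction d
              (intersect⇒¬disjoint (intervals (force b p)) (intervals (force b′ q))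
                (meet {intervals (force b p)} {intervals (force b′ q)} zero z≤n z≤n))
      ... | ordered j w | _ = contradiction d
              (intersect⇒¬disjoint (intervals (force b p)) (intervals (ordered j w))
                (meet {intervals (force b p)} {intervals (ordered j w)} (suc (suc zero)) z≤n z≤n))
      ... | nonEdge i j a c | _ = contradiction d
              (intersect⇒¬disjoint (intervals (force b p)) (intervals (nonEdge i j a c))
                (meet {intervals (force b p)} {intervals (nonEdge i j a c)} zero z≤n z≤n))
      ... | choice q x | choice q<K x<n with q ≟ p
      ...   | yes refl = x , refl , x<n
      ...   | no  q≢p  = contradiction d
              (intersect⇒¬disjoint (intervals (force b p)) (intervals (choice q x))
                (force-choice-meet {b} {p} {q} {x} q≢p q<K (<⇒≤ x<n)))

      -- The second case, where both twins of a group lie in `D`, is kept only until counting rules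
      -- it out.
      Selected : ℕ → Node → Set
      Selected p u =
        (∃[ x ] (kind u ≡ choice p x × x < n)) ⊎
        (kind u ≡ force false p × ∃[ v ] (v ∈ D × kind v ≡ force true p))

      force-dominated : ∀ b {p} → p < k * 2 →
        (∃[ u ] (u ∈ D × kind u ≡ force b p)) ⊎
        (∃[ u ] (u ∈ D × ∃[ x ] (kind u ≡ choice p x × x < n)))
      force-dominated b {p} p<K with dominating (node (force {b} p<K))
      ... | inj₁ f∈D = inj₁ (_ , f∈D , kind-node (force p<K))
      ... | inj₂ (u , u∈D , d) = inj₂ (u , u∈D , force-neighbour {b} {p} {u}
              (subst (λ κ → T (disjoint (intervals κ) (intervals (kind u)))) (kind-node (force {b} p<K)) d))

      select : ∀ {p} → p < k * 2 → ∃[ u ] (u ∈ D × Selected p u)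
      select p<K with force-dominated false p<K | force-dominated true p<K
      ... | inj₂ (u , u∈D , c)  | _                    = u , u∈D , inj₁ c
      ... | inj₁ _              | inj₂ (u , u∈D , c)   = u , u∈D , inj₁ c
      ... | inj₁ (u , u∈D , eq) | inj₁ (v , v∈D , eq′) = u , u∈D , inj₂ (eq , v , v∈D , eq′)

      member : Fin (k * 2) → Node
      member p = proj₁ (select (Fin.toℕ<n p))

      member∈D : ∀ p → member p ∈ D
      member∈D p = proj₁ (proj₂ (select (Fin.toℕ<n p)))

      member-selected : ∀ p → Selected (toℕ p) (member p)
      member-selected p = proj₂ (proj₂ (select (Fin.toℕ<n p)))

      member-group : ∀ p → group (kind (member p)) ≡ toℕ p
      member-group p with member-selected p
      ... | inj₁ (_ , eq , _) = cong group eq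
      ... | inj₂ (eq , _)     = cong group eq

      member-injective : ∀ {p q} → member p ≡ member q → p ≡ q
      member-injective {p} {q} eq = Fin.toℕ-injective
        (trans (sym (member-group p)) (trans (cong (group ∘ kind) eq) (member-group q)))

      member-surjective : ∀ {d} → d ∈ D → ∃[ p ] d ≡ member p
      member-surjective = full-image member member-injective |D| member∈D

      -- If no choice is selected for a group, then both of its twins lie in
      -- D, but D has room for only one node per group.
      member-choice : ∀ p → ∃[ x ] (kind (member p) ≡ choice (toℕ p) x × x < n)
      member-choice p with member-selected p
      ... | inj₁ c = c
      ... | inj₂ (_ , v , v∈D , v≡) with member-surjective v∈D
      ...   | q , refl with member-selected q
      ...     | inj₁ (_ , eq , _) with () ← trans (sym v≡) eq
      ...     | inj₂ (eq , _)     with () ← trans (sym v≡) eq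

      z : ℕ → ℕ
      z = cells (tabulate (proj₁ ∘ member-choice))

      z≡ : ∀ p → z (toℕ p) ≡ proj₁ (member-choice p)
      z≡ = cells-tabulate (proj₁ ∘ member-choice)

      z<n : ∀ {p} → p < k * 2 → z p < n
      z<n p<K = subst (λ q → z q < n) (Fin.toℕ-fromℕ< p<K)
        (subst (_< n) (sym (z≡ (fromℕ< p<K))) (proj₂ (proj₂ (member-choice (fromℕ< p<K)))))

      D-choices : ∀ {d} → d ∈ D → ∃[ q ] (q < k * 2 × kind d ≡ choice q (z q))
      D-choices d∈D with member-surjective d∈D
      ... | p , refl = toℕ p , Fin.toℕ<n p ,
        trans (proj₁ (proj₂ (member-choice p))) (cong (choice (toℕ p)) (sym (z≡ p)))

      -- `D` consists of choices alone, so a node of another kind needs a disjoint choice in `D`.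
      refute : ∀ {κ} → Valid κ → (∀ q x → κ ≢ choice q x) →
        ¬ (∀ {q} → q < k * 2 → Intersect (intervals κ) (intervals (choice q (z q))))
      refute {κ} κ✓ κ≢ meets with dominating (node κ✓)
      ... | inj₁ v∈D with D-choices v∈D
      ...   | q , _ , eq = κ≢ q (z q) (trans (sym (kind-node κ✓)) eq)
      refute {κ} κ✓ κ≢ meets | inj₂ (u , u∈D , d) with D-choices u∈D
      ... | q , q<K , eq = intersect⇒¬disjoint (intervals κ) (intervals (choice q (z q))) (meets q<K)
        (subst₂ (λ κ₁ κ₂ → T (disjoint (intervals κ₁) (intervals κ₂))) (kind-node κ✓) eq d)

      -- Otherwise the `ordered` interval with threshold n ∸ z (2j) would meet every choice in `D`.
      -- The threshold is below n because z (2j) exceeds z (2j + 1) and is thus positive.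
      even≤odd : ∀ {j} → j < k → z (j * 2) ≤ z (suc (j * 2))
      even≤odd {j} j<k with z (j * 2) ≤? z (suc (j * 2))
      ... | yes x≤y = x≤y
      ... | no  x≰y = contradiction
        (λ {q} q<K → ordered-choice-meet j<k w<n q<K (<⇒≤ (z<n q<K)) (λ { refl → ≤-refl })
          (λ { refl → ∸-monoʳ-< (≰⇒> x≰y) x≤n }))
        (refute (ordered j<k w<n) λ _ _ ())
        where
        x≤n = <⇒≤ (z<n (even-< j<k))
        w<n : n ∸ z (j * 2) < n
        w<n = ∸-monoʳ-< {n} (≤-<-trans z≤n (≰⇒> x≰y)) x≤n

    dominating⇒solution : Solution
    dominating⇒solution = record
      { vertex   = λ j → z (j * 2)
      ; vertex<n = z<n ∘ even-<
      ; linked   = λ {i} {j} i<j j<k ij≡0 →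
          let x<n = z<n (even-< (<-trans i<j j<k)) ; y<n = z<n (even-< j<k) in
          -- With a = z (2i) and b = z (2j) the even groups meet their thresholds with equality, the
          -- odd ones by `even≤odd`.
          refute (nonEdge i<j j<k x<n y<n ij≡0) (λ _ _ ()) λ q<K →
            nonEdge-choice-meet i<j j<k x<n y<n q<K (<⇒≤ (z<n q<K))
              (λ { refl → ≤-refl }) (λ { refl → even≤odd (<-trans i<j j<k) })
              (λ { refl → ≤-refl }) (λ { refl → even≤odd j<k })
      }

-- Cliques of the input graph and the reduced instance

adjacencyBits : Graph → List ℕ
adjacencyBits G =
  concatMap (λ u → map (λ v → bit (adj G u v)) (allFin (order G))) (allFin (order G))

module _ (G : Graph) where

  private
    n = order G

    row : Fin n → List ℕ
    row u = map (λ v → bit (adj G u v)) (allFin n)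

    row-tabulate : ∀ u → row u ≡ tabulate (λ v → bit (adj G u v))
    row-tabulate u = map-tabulate id _

    row-length : ∀ u → length (row u) ≡ n
    row-length u = trans (cong length (row-tabulate u)) (length-tabulate _)

    rows : adjacencyBits G ≡ concat (tabulate row)
    rows = cong concat (map-tabulate id row)

  length-adjacencyBits : length (adjacencyBits G) ≡ n * n
  length-adjacencyBits = trans (cong length rows) (length-concat-tabulate row row-length)

  cells-adjacencyBits : ∀ u v → cells (adjacencyBits G) (toℕ v + toℕ u * n) ≡ bit (adj G u v)
  cells-adjacencyBits u v = trans
    (cong (λ l → cells l (toℕ v + toℕ u * n)) rows)
    (trans (cells-concat-tabulate row row-length u (Fin.toℕ<n v))
      (trans (cong (λ l → cells l (toℕ v)) (row-tabulate u)) (cells-tabulate _ v)))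

bit-T : ∀ {b} → T b → bit b ≢ 0
bit-T {true} _ ()

T-bit : ∀ {b} → bit b ≢ 0 → T b
T-bit {true}  _  = _
T-bit {false} ≢0 = contradiction refl ≢0

module Reduction (x : GraphInstance) where

  open GraphInstance x

  n : ℕ
  n = order graph

  bits : List ℕ
  bits = adjacencyBits graph

  open Layout k n public using (intervals; encodeKind)
  open Table k n bits public using (table; entry)
  open Correspondence k n bits public

  private
    entry-adj : ∀ u v → entry (toℕ u) (toℕ v) ≡ bit (adj graph u v)
    entry-adj = cells-adjacencyBits graph

  clique⇒solution : HasCliqueOfSize graph k → Solution
  clique⇒solution (C , |C| , clique) with enumerate C |C|
  ... | f , inj , f∈C = record
    { vertex   = vertex
    ; vertex<n = λ {j} j<k → subst (_< n) (sym (vertex≡ j<k)) (Fin.toℕ<n _)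
    ; linked   = λ {i} {j} i<j j<k ij≡0 →
        let i<k = <-trans i<j j<k in
        bit-T (clique (f∈C _) (f∈C _)
                (λ eq → <⇒≢ i<j (Fin.fromℕ<-injective i j i<k j<k (inj eq))))
          (trans (sym (entry-adj (f (fromℕ< i<k)) (f (fromℕ< j<k))))
            (trans (sym (cong₂ entry (vertex≡ i<k) (vertex≡ j<k))) ij≡0))
    }
    where
    vertex : ℕ → ℕ
    vertex = cells (tabulate (toℕ ∘ f))
    vertex≡ : ∀ {j} (j<k : j < k) → vertex j ≡ toℕ (f (fromℕ< j<k))
    vertex≡ j<k = trans (cong vertex (sym (Fin.toℕ-fromℕ< j<k))) (cells-tabulate (toℕ ∘ f) (fromℕ< j<k))

  solution⇒clique : Solution → HasCliqueOfSize graph k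
  solution⇒clique S = image f , ∣image∣ f (λ {i} {j} → f-injective i j) , clique
    where
    open Solution S
    f : Fin k → Fin n
    f i = fromℕ< (vertex<n (Fin.toℕ<n i))
    f≡ : ∀ i → toℕ (f i) ≡ vertex (toℕ i)
    f≡ i = Fin.toℕ-fromℕ< _
    ordered-adjacent : ∀ {i j} → toℕ i < toℕ j → Adjacent graph (f i) (f j)
    ordered-adjacent {i} {j} i<j = T-bit λ ≡0 → linked i<j (Fin.toℕ<n j)
      (trans (sym (cong₂ entry (f≡ i) (f≡ j))) (trans (entry-adj (f i) (f j)) ≡0))
    f-adjacent : ∀ i j → i ≢ j → Adjacent graph (f i) (f j)
    f-adjacent i j i≢j with <-cmp (toℕ i) (toℕ j)
    ... | tri< i<j _ _ = ordered-adjacent i<j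
    ... | tri≈ _ i≡j _ = contradiction (Fin.toℕ-injective i≡j) i≢j
    ... | tri> _ _ j<i = subst T (adj-sym graph (f j) (f i)) (ordered-adjacent j<i)
    -- Distinct indices give adjacent vertices, and no vertex is adjacent to itself.
    f-injective : ∀ i j → f i ≡ f j → i ≡ j
    f-injective i j eq with i Fin.≟ j
    ... | yes i≡j = i≡j
    ... | no  i≢j = contradiction
      (subst T (trans (cong (adj graph (f i)) (sym eq)) (adj-irrefl graph (f i))) (f-adjacent i j i≢j)) id
    clique : IsClique graph (image f)
    clique u∈ v∈ u≢v with ∈-image⁻ f u∈ | ∈-image⁻ f v∈
    ... | i , refl | j , refl = f-adjacent i j (u≢v ∘ cong f)

  clique⇔dominatingClique : HasCliqueOfSize graph k ⇔ HasDominatingCliqueOfSize H (k * 2)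
  clique⇔dominatingClique = mk⇔
    (solution⇒dominatingClique ∘ clique⇒solution)
    (λ (D , |D| , dominating , _) → solution⇒clique (dominating⇒solution D |D| dominating))

  -- In a dominating clique single edges serve as the connecting paths; the way back uses domination
  -- as before.
  clique⇔connectedDominating : HasCliqueOfSize graph k ⇔ HasConnectedDominatingSetOfSize H (k * 2)
  clique⇔connectedDominating = mk⇔
    (λ C → connected (clique⇔dominatingClique .Equivalence.to C))
    (λ (D , |D| , dominating , _) → solution⇒clique (dominating⇒solution D |D| dominating))
    where
    connected : HasDominatingCliqueOfSize H (k * 2) → HasConnectedDominatingSetOfSize H (k * 2)
    connected (D , |D| , dominating , clique) = D , |D| , dominating , λ {u} {v} → path u v
      where
      path : ∀ u v → u ∈ D → v ∈ D → _
      path u v u∈D v∈D with u Fin.≟ v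
      ... | yes refl = ε
      ... | no  u≢v  = (u∈D , v∈D , clique u∈D v∈D u≢v) ◅ ε

  reduced : Co3TrackInstance
  reduced = record
    { graph          = H
    ; intervals      = intervals ∘ kind
    ; representation = disjointnessGraph-representation (intervals ∘ kind)
    ; k              = k * 2
    }

  module _ (m : ℕ) .{{_ : NonZero m}} (k≤m : k ≤ m) (n≤m : n ≤ m) (N≤m : length table ≤ m) where

    open Bounded m
    open Correctness m k n bits (length-adjacencyBits graph) k≤m n≤m N≤m

    private
      endpointAt≡ : ∀ (v : Node) {c} → c < 6 → endpointAt c (toℕ v) ≡ cells (encodeKind (kind v)) c
      endpointAt≡ v {c} c<6 = trans
        (cells-++ʳ word (c + toℕ v * 6))
        (trans (cong (λ l → cells l (c + toℕ v * 6)) flat)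
          (cells-concat-tabulate (encodeKind ∘ kind) (λ _ → refl) v c<6))
        where
        flat : concatMap encodeKind table ≡ concat (tabulate (encodeKind ∘ kind))
        flat = cong concat (trans (cong (map encodeKind) (sym (tabulate-lookup table)))
                                  (map-tabulate kind encodeKind))

      gapAt≡ : ∀ u v {c} → suc c < 6 → gapAt c (toℕ u) (toℕ v) ≡
        (cells (encodeKind (kind u)) c ∸ cells (encodeKind (kind v)) (suc c)) +
        (cells (encodeKind (kind v)) c ∸ cells (encodeKind (kind u)) (suc c))
      gapAt≡ u v lt = cong₂ _+_
        (cong₂ _∸_ (endpointAt≡ u (<-trans (n<1+n _) lt)) (endpointAt≡ v lt))
        (cong₂ _∸_ (endpointAt≡ v (<-trans (n<1+n _) lt)) (endpointAt≡ u lt))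

      adjacencyAt≡ : ∀ u v → bit (adj H u v) ≡ adjacencyAt (toℕ u) (toℕ v)
      adjacencyAt≡ u v = trans (bit-disjoint (intervals (kind u)) (intervals (kind v)))
        (sym (cong (_∸ 2) (cong₂ _+_ (cong sgn (gapAt≡ u v (s≤s (s≤s z≤n))))
          (cong₂ _+_ (cong sgn (gapAt≡ u v (s≤s (s≤s (s≤s (s≤s z≤n))))))
                     (cong sgn (gapAt≡ u v (s≤s (s≤s (s≤s (s≤s (s≤s (s≤s z≤n))))))))))))

      matrix≡ : adjacencyBits H ≡ matrix
      matrix≡ = concatMap-allFin _ (λ u → collect (λ v → [ adjacencyAt u v ]) (length table)) λ u →
        map-allFin _ (adjacencyAt (toℕ u)) (adjacencyAt≡ u)

      endpoints≡ : concatMap (encodeKind ∘ kind) (allFin (length table)) ≡ endpoints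
      endpoints≡ = concatMap-allFin _
        (λ u → map (λ c → endpointAt c u) (0 ∷ 1 ∷ 2 ∷ 3 ∷ 4 ∷ 5 ∷ [])) λ v → sym
        (cong₂ _∷_ (endpointAt≡ v (s≤s z≤n))
        (cong₂ _∷_ (endpointAt≡ v (s≤s (s≤s z≤n)))
        (cong₂ _∷_ (endpointAt≡ v (s≤s (s≤s (s≤s z≤n))))
        (cong₂ _∷_ (endpointAt≡ v (s≤s (s≤s (s≤s (s≤s z≤n)))))
        (cong₂ _∷_ (endpointAt≡ v (s≤s (s≤s (s≤s (s≤s (s≤s z≤n))))))
        (cong₂ _∷_ (endpointAt≡ v (s≤s (s≤s (s≤s (s≤s (s≤s (s≤s z≤n)))))))
        refl))))))

      k+k≡k*2 : k + k ≡ k * 2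
      k+k≡k*2 = trans (cong (k +_) (sym (+-identityʳ k))) (*-comm 2 k)

      output≡ : k + k ∷ length table ∷ matrix ++ endpoints ≡ encodeCo3Track reduced
      output≡ = cong₂ _∷_ k+k≡k*2
        (cong (length table ∷_) (cong₂ _++_ (sym matrix≡) (sym endpoints≡)))

    reduction-outputs : reduction on encode k-Clique x Outputs encodeCo3Track reduced
      Within (coefficient reduction * m ^ depth reduction)
    reduction-outputs = run-outputs {r = 13} reduction-run output≡

-- Running time

length-collect : ∀ {A : Set} (g : ℕ → List A) {b} n → (∀ {i} → i < n → length (g i) ≤ b) →
  length (collect g n) ≤ n * b
length-collect g zero    |g|≤ = z≤n
length-collect g {b} (suc n) |g|≤ = subst₂ _≤_ (sym (length-++ (collect g n))) (+-comm (n * b) b)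
  (+-mono-≤ (length-collect g n (|g|≤ ∘ m<n⇒m<1+n)) (|g|≤ ≤-refl))

length-unlessNonZero : ∀ {A : Set} c (y : A) → length (unlessNonZero c y) ≤ 1
length-unlessNonZero zero    y = s≤s z≤n
length-unlessNonZero (suc c) y = z≤n

-- Each of the `k` rows has four force intervals, 3n choice and `ordered` intervals and at most k *
-- n * n `nonEdge` intervals; 8 is 4 + 3 + 1, as q ≥ 1.
length-table : ∀ k n bits {q} → k ≤ q → n ≤ q → .{{_ : NonZero q}} →
  length (Table.table k n bits) ≤ 8 * q ^ 4
length-table k n bits {q} k≤q n≤q = begin
  length table
    ≤⟨ length-collect _ k row-≤ ⟩
  k * (4 + (n * 3 + k * (n * (n * 1))))
    ≤⟨ *-mono-≤ k≤q (+-monoʳ-≤ 4 (+-mono-≤ (*-monoˡ-≤ 3 n≤q)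
         (*-mono-≤ k≤q (*-mono-≤ n≤q (*-monoˡ-≤ 1 n≤q))))) ⟩
  q * (4 + (q * 3 + q ^ 3))
    ≤⟨ *-monoʳ-≤ q (+-mono-≤ (*-monoʳ-≤ 4 1≤q³)
         (+-monoˡ-≤ (q ^ 3) (≤-trans (≤-reflexive (*-comm q 3)) (*-monoʳ-≤ 3 q≤q³)))) ⟩
  q * (4 * q ^ 3 + (3 * q ^ 3 + q ^ 3))
    ≡⟨ cong (q *_) (trans (cong (4 * q ^ 3 +_) (+-comm (3 * q ^ 3) (q ^ 3)))
         (sym (*-distribʳ-+ (q ^ 3) 4 4))) ⟩
  q * (8 * q ^ 3)
    ≡⟨ x∙yz≈y∙xz *-commutativeSemigroup q 8 (q ^ 3) ⟩
  8 * q ^ 4 ∎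
  where
  open ≤-Reasoning
  open Table k n bits
  1≤q³ : 1 ≤ q ^ 3
  1≤q³ = m^n>0 q 3
  q≤q³ : q ≤ q ^ 3
  q≤q³ = m≤m*n q (q ^ 2) {{m^n≢0 q 2}}
  row-≤ : ∀ {j} → j < k → length (selectors j ++ collect (choices j) n ++ collect (nonEdges j) j)
                          ≤ 4 + (n * 3 + k * (n * (n * 1)))
  row-≤ {j} j<k = +-monoʳ-≤ 4 (≤-trans (≤-reflexive (length-++ (collect (choices j) n)))
    (+-mono-≤ (length-collect (choices j) n (λ _ → ≤-refl))
      (≤-trans (length-collect (nonEdges j) j λ _ → length-collect _ n λ {a} _ →
                 length-collect _ n λ {b} _ → length-unlessNonZero (entry a b) _)
               (*-monoˡ-≤ _ (<⇒≤ j<k)))))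

length≤size : ∀ w → length w ≤ size w
length≤size []      = z≤n
length≤size (a ∷ w) = s≤s (≤-trans (length≤size w) (m≤n+m (size w) ⌊log₂ a ⌋))

k<2^k : ∀ k → k < 2 ^ k
k<2^k zero    = s≤s z≤n
k<2^k (suc k) = +-mono-≤ (m^n>0 2 k) (subst (suc k ≤_) (sym (+-identityʳ _)) (k<2^k k))

-- Computability of the time and parameter bounds

timesExpr : ℕ → Expr → Expr
timesExpr zero    e = lit 0
timesExpr (suc d) e = e ⊕ timesExpr d e

⟦timesExpr⟧ : ∀ d e σ → ⟦ timesExpr d e ⟧ σ ≡ d * ⟦ e ⟧ σ
⟦timesExpr⟧ zero    e σ = refl
⟦timesExpr⟧ (suc d) e σ = cong (⟦ e ⟧ σ +_) (⟦timesExpr⟧ d e σ)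

-- The base `d` is fixed in the program, so each multiplication unrolls into a sum of `d` copies.
exponential-computable : ∀ c d → Computable (λ k → d ^ k * c)
-- The loop makes `k` rounds; `suc k` is a bound that is nonzero also for k = 0.
exponential-computable c d = program , λ k → _ , Bounded.run-outputs (suc k) {r = 2} (run k) refl
  where
  program = 1 := load (lit 0) ⨾ 2 := lit c ⨾
    whileNonZero (var 1) (2 := timesExpr d (var 2) ⨾ 1 := (var 1 ⊖ lit 1)) ⨾
    write (var 2)
  module _ (k : ℕ) where
    open Bounded (suc k)
    family : ℕ → Configuration
    family i = ⟪ k ∸ i ∷ d ^ i * c ∷ [] , [ k ] , [] ⟫
    step : ∀ i →
      setRegister 0 (k ∸ i ∸ 1) (setRegister 1 (⟦ timesExpr d (var 2) ⟧ᶜ (family i)) (family i))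
        ≡ family (suc i)
    step i = cong₂ (λ a b → ⟪ a ∷ b ∷ [] , [ k ] , [] ⟫)
      (trans (∸-+-assoc k i 1) (cong (k ∸_) (+-comm i 1)))
      (trans (⟦timesExpr⟧ d (var 2) _) (sym (*-assoc d (d ^ i) c)))
    run : program ⊢ ⟪ 0 ∷ 0 ∷ [] , [ k ] , [] ⟫ ⟶ ⟪ 0 ∷ d ^ k * c ∷ [] , [ k ] , [ d ^ k * c ] ⟫
    run = assign-run 0 (load (lit 0)) ⨟
      retarget (cong (λ a → ⟪ k ∷ a ∷ [] , [ k ] , [] ⟫) (sym (*-identityˡ c))) (assign-run 1 (lit c)) ⨟
      retarget (cong (λ a → ⟪ a ∷ d ^ k * c ∷ [] , [ k ] , [] ⟫) (n∸n≡0 k))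
        (while-run family m>n⇒m∸n≢0 (n∸n≡0 k)
          (λ {i} _ → assign-run 1 (timesExpr d (var 2)) ⨟ retarget (step i) (assign-run 0 (var 1 ⊖ lit 1)))
          (n≤1+n k)) ⨟
      write-run (var 2)

double-computable : Computable (_* 2)
double-computable = write (load (lit 0) ⊕ load (lit 0)) , λ k →
  _ , _ , _ , write⇓ , cong [_] (trans (cong (k +_) (sym (+-identityʳ k))) (*-comm 2 k)) , ≤-refl

^-distribʳ-* : ∀ a b e → (a * b) ^ e ≡ a ^ e * b ^ e
^-distribʳ-* a b zero    = refl
^-distribʳ-* a b (suc e) = trans (cong (a * b *_) (^-distribʳ-* a b e))
  (interchange *-commutativeSemigroup a b (a ^ e) (b ^ e))

growth : ℕ → ℕ
growth d  = 2 ^ (4 * d)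

scale : ℕ → ℕ → ℕ
scale c d = c * 8 ^ d

-- Splits the step bound c * m ^ d, for m = 8 * (2 ^ k * s) ^ 4, into a factor depending on the
-- parameter and a power of the input size.
polynomial≡ : ∀ c d k s →
  c * (8 * (2 ^ k * s) ^ 4) ^ d ≡ growth d ^ k * scale c d * s ^ (4 * d)
polynomial≡ c d k s = begin
  c * (8 * q ^ 4) ^ d                         ≡⟨ cong (c *_) (^-distribʳ-* 8 (q ^ 4) d) ⟩
  c * (8 ^ d * (q ^ 4) ^ d)                   ≡⟨ *-assoc c (8 ^ d) _ ⟨
  scale c d * (q ^ 4) ^ d                     ≡⟨ cong (scale c d *_) (^-*-assoc q 4 d) ⟩
  scale c d * q ^ (4 * d)                     ≡⟨ cong (scale c d *_) (^-distribʳ-* (2 ^ k) s (4 * d)) ⟩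
  scale c d * ((2 ^ k) ^ (4 * d) * s ^ (4 * d))
    ≡⟨ *-assoc (scale c d) ((2 ^ k) ^ (4 * d)) _ ⟨
  scale c d * (2 ^ k) ^ (4 * d) * s ^ (4 * d)
    ≡⟨ cong (_* s ^ (4 * d)) (*-comm (scale c d) ((2 ^ k) ^ (4 * d))) ⟩
  (2 ^ k) ^ (4 * d) * scale c d * s ^ (4 * d)
    ≡⟨ cong (λ a → a * scale c d * s ^ (4 * d)) swap ⟩
  growth d ^ k * scale c d * s ^ (4 * d)      ∎
  where
  open ≡-Reasoning
  q = 2 ^ k * s
  swap : (2 ^ k) ^ (4 * d) ≡ growth d ^ k
  swap = trans (^-*-assoc 2 k (4 * d))
    (trans (cong (2 ^_) (*-comm k (4 * d))) (sym (^-*-assoc 2 (4 * d) k)))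

reductionGrowth reductionScale : ℕ
reductionGrowth = growth (depth reduction)
reductionScale  = scale (coefficient reduction) (depth reduction)

-- The size `s` counts only the bits of `k`, so `k` may be exponential in `s`; the factor 2 ^ k in
-- `q` moves the dependence on `k` into the part governed by the parameter.
reduction-runtime : ∀ x → reduction on encode k-Clique x Outputs encodeCo3Track (Reduction.reduced x)
  Within (reductionGrowth ^ GraphInstance.k x * reductionScale *
          size (encode k-Clique x) ^ (4 * depth reduction))
reduction-runtime x = within
  (≤-reflexive (polynomial≡ (coefficient reduction) (depth reduction) k s))
  (Reduction.reduction-outputs x m k≤m n≤m N≤m)
  where
  open GraphInstance x
  n = order graph
  s = size (encode k-Clique x)
  q = 2 ^ k * s
  m = 8 * q ^ 4
  |w|≤s : suc (suc (n * n)) ≤ s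
  |w|≤s = subst (λ l → suc (suc l) ≤ s) (length-adjacencyBits graph) (length≤size (encode k-Clique x))
  instance
    s≢0 : NonZero s
    s≢0 = >-nonZero (≤-trans (s≤s z≤n) |w|≤s)
    2^k≢0 : NonZero (2 ^ k)
    2^k≢0 = m^n≢0 2 k
    q≢0 : NonZero q
    q≢0 = m*n≢0 (2 ^ k) s
    q⁴≢0 : NonZero (q ^ 4)
    q⁴≢0 = m^n≢0 q 4
    m≢0 : NonZero m
    m≢0 = m*n≢0 8 (q ^ 4)
  n≤n*n : ∀ a → a ≤ a * a
  n≤n*n zero    = z≤n
  n≤n*n (suc a) = m≤m*n (suc a) (suc a)
  k≤q : k ≤ q
  k≤q = ≤-trans (<⇒≤ (k<2^k k)) (m≤m*n (2 ^ k) s)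
  n≤q : n ≤ q
  n≤q = ≤-trans (≤-trans (n≤n*n n) (≤-trans (m≤n+m (n * n) 2) |w|≤s)) (m≤n*m s (2 ^ k))
  q≤m : q ≤ m
  q≤m = ≤-trans (m≤m*n q (q ^ 3) {{m^n≢0 q 3}}) (m≤n*m (q ^ 4) 8)
  k≤m = ≤-trans k≤q q≤m
  n≤m = ≤-trans n≤q q≤m
  N≤m = length-table k n (adjacencyBits graph) k≤q n≤q
  within : ∀ {p w w′ a b} → a ≤ b → p on w Outputs w′ Within a → p on w Outputs w′ Within b
  within a≤b (τ , t , run , out , t≤a) = τ , t , run , out , ≤-trans t≤a a≤b

-- The two problems differ in their yes-instances alone, so one reduction and one time bound serve
-- both.
w[1]-hard : (Yes′ : Co3TrackInstance → Set) →
  (∀ x → Yes k-Clique x ⇔ Yes′ (Reduction.reduced x)) →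
  W[1]-Hard (record { Instance = Co3TrackInstance ; encode = encodeCo3Track
                    ; parameter = Co3TrackInstance.k ; Yes = Yes′ })
w[1]-hard Yes′ equiv = record
  { reduce       = Reduction.reduced
  ; equivalent   = equiv
  ; program      = reduction
  ; g            = λ k → reductionGrowth ^ k * reductionScale
  ; h            = _* 2
  ; g-computable = exponential-computable reductionScale reductionGrowth
  ; h-computable = double-computable
  ; degree       = 4 * depth reduction
  ; runtime      = reduction-runtime
  ; parameter-≤  = λ _ → ≤-refl
  }

theorem3 : W[1]-Hard k-ConnectedDominatingSet-Co3Track × W[1]-Hard k-DominatingClique-Co3Track
theorem3 = w[1]-hard _ Reduction.clique⇔connectedDominating
         , w[1]-hard _ Reduction.clique⇔dominatingClique
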